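{- Let $G$ be a finite simple graph that contains no subdivision of $K_5$ as a subgraph. Then $\tau(G) \leq 2\nu(G)$.
   Context: $\nu(G)$ is the maximum number of pairwise edge-disjoint triangles in $G$. $\tau(G)$ is the minimum size of an edge set $Y \subseteq E(G)$ such that $G - Y$ is triangle-free. -}

module Defs where

open import Data.Fin.Base using (Fin; _<_; combine)
open import Data.Fin.Properties as Fin using (any?; _<?_; combine-injective; injective⇒≤)
open import Data.List.Base using (List; []; _∷_; _++_; length; lookup; filter; cartesianProduct; allFin)
open import Data.List.Membership.Propositional using (_∈_; _∉_)
import Data.List.Membership.DecPropositional as DecMembership
open import Data.List.Membership.Propositional.Properties
  using (∈-filter⁺; ∈-cartesianProduct⁺; ∈-allFin; ∈-lookup)
open import Data.List.Relation.Binary.Disjoint.Propositional using (Disjoint)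
open import Data.List.Relation.Unary.All as All using (All; []; _∷_)
open import Data.List.Relation.Unary.All.Properties using (all-filter)
open import Data.List.Relation.Unary.AllPairs as AllPairs using (AllPairs; []; _∷_)
open import Data.List.Relation.Unary.Any using (here; there)
open import Data.List.Relation.Unary.Linked using (Linked)
open import Data.List.Relation.Unary.Unique.Propositional using (Unique)
import Data.List.Relation.Unary.Unique.DecPropositional as DecUnique
import Data.List.Relation.Unary.Unique.Propositional.Properties as Unique
open import Data.Nat.Base as ℕ using (ℕ; zero; suc; _≤_; z≤n)
import Data.Nat.Properties as ℕ
open import Data.Product.Base using (Σ; ∃; ∃₂; _×_; _,_; proj₁; proj₂)
open import Data.Product.Properties using (≡-dec)
open import Data.Sum.Base using (_⊎_)
open import Function.Base using (_∘_)
open import Function.Definitions using (Injective)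
open import Level using (0ℓ)
open import Relation.Binary.Core using (Rel)
open import Relation.Binary.Definitions using (DecidableEquality)
import Relation.Binary.Definitions as Binary
open import Relation.Binary.PropositionalEquality.Core using (_≡_; _≢_; refl; sym; cong; ≢-sym)
open import Relation.Nullary.Decidable using (Dec; yes; no; map′; ¬?; _×-dec_)
open import Relation.Nullary.Negation using (¬_; contradiction)
open import Relation.Unary using (Pred; Decidable)

------------------------------------------------------------------------
-- Graphs

record Graph (n : ℕ) : Set₁ where
  field
    Adj    : Rel (Fin n) 0ℓ
    adj?   : Binary.Decidable Adj
    symm   : Binary.Symmetric Adj
    irrefl : Binary.Irreflexive _≡_ Adj

open Graph public

Pair : ℕ → Set
Pair n = Fin n × Fin n

_≟ᵖ_ : ∀ {n} → DecidableEquality (Pair n)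
_≟ᵖ_ = ≡-dec Fin._≟_ Fin._≟_

-- An edge {u , v} is listed exactly once, as the pair (u , v) with u < v.

IsEdge : ∀ {n} → Graph n → Pair n → Set
IsEdge G (u , v) = u < v × Adj G u v

complete : ∀ k → Graph k
complete k = record
  { Adj    = _≢_
  ; adj?   = λ i j → ¬? (i Fin.≟ j)
  ; symm   = ≢-sym
  ; irrefl = λ i≡j i≢j → i≢j i≡j
  }

_-ᵉ_ : ∀ {n} → Graph n → List (Pair n) → Graph n
_-ᵉ_ {n} G Y = record
  { Adj    = λ u v → Adj G u v × (u , v) ∉ Y × (v , u) ∉ Y
  ; adj?   = λ u v → adj? G u v ×-dec ¬? ((u , v) ∈? Y) ×-dec ¬? ((v , u) ∈? Y)
  ; symm   = λ (a , p , q) → symm G a , q , p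
  ; irrefl = λ u≡v (a , _) → irrefl G u≡v a
  }
  where open DecMembership (_≟ᵖ_ {n}) using (_∈?_)

------------------------------------------------------------------------
-- Subgraphs and subdivisions

record Subgraph {n} (G : Graph n) : Set₁ where
  field
    Vertex  : Pred (Fin n) 0ℓ
    Adjˢ    : Rel (Fin n) 0ℓ
    symmˢ   : Binary.Symmetric Adjˢ
    inside  : ∀ {u v} → Adjˢ u v → Adj G u v
    endsˢ   : ∀ {u v} → Adjˢ u v → Vertex u × Vertex v

Consecutive : ∀ {A : Set} → A → A → List A → Set
Consecutive u v xs = ∃₂ λ ps qs → xs ≡ ps ++ u ∷ v ∷ qs

-- H arises from K by replacing the edges of K by internally disjoint paths
-- that have no inner vertex among the branch vertices.  The value of inner
-- at a pair that is not an edge of K plays no role.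

record IsSubdivision {k n} {G : Graph n} (K : Graph k) (H : Subgraph G) : Set where
  open Subgraph H
  field
    branch           : Fin k → Fin n
    branch-injective : Injective _≡_ _≡_ branch
    branch-vertex    : ∀ i → Vertex (branch i)
    inner            : Pair k → List (Fin n)

  path : Pair k → List (Fin n)
  path (i , j) = branch i ∷ inner (i , j) ++ branch j ∷ []

  field
    path-linked    : ∀ {e} → IsEdge K e → Linked Adjˢ (path e)
    path-unique    : ∀ {e} → IsEdge K e → Unique (path e)
    inner∌branch   : ∀ {e} → IsEdge K e → ∀ i → branch i ∉ inner e
    inner-disjoint : ∀ {e f} → IsEdge K e → IsEdge K f → e ≢ f →
                     Disjoint (inner e) (inner f)
    cover-vertices : ∀ {v} → Vertex v →
                     (∃ λ i → v ≡ branch i) ⊎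
                     (∃ λ e → IsEdge K e × v ∈ inner e)
    cover-edges    : ∀ {u v} → Adjˢ u v →
                     ∃ λ e → IsEdge K e ×
                       (Consecutive u v (path e) ⊎ Consecutive v u (path e))

ContainsSubdivision : ∀ {k n} → Graph k → Graph n → Set₁
ContainsSubdivision K G = Σ (Subgraph G) (IsSubdivision K)

------------------------------------------------------------------------
-- Triangles, packings and covers

Triple : ℕ → Set
Triple n = Fin n × Fin n × Fin n

-- As with edges, each triangle is listed exactly once, in increasing order.

IsTriangle : ∀ {n} → Graph n → Triple n → Set
IsTriangle G (a , b , c) =
  a < b × b < c × Adj G a b × Adj G b c × Adj G a c

triangleEdges : ∀ {n} → Triple n → List (Pair n)
triangleEdges (a , b , c) = (a , b) ∷ (b , c) ∷ (a , c) ∷ []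

EdgeDisjoint : ∀ {n} → Rel (Triple n) 0ℓ
EdgeDisjoint s t = Disjoint (triangleEdges s) (triangleEdges t)

IsPacking : ∀ {n} → Graph n → List (Triple n) → Set
IsPacking G ts = All (IsTriangle G) ts × AllPairs EdgeDisjoint ts

TriangleFree : ∀ {n} → Graph n → Set
TriangleFree G = ∀ t → ¬ IsTriangle G t

IsCover : ∀ {n} → Graph n → List (Pair n) → Set
IsCover G Y = All (IsEdge G) Y × Unique Y × TriangleFree (G -ᵉ Y)

HasPackingOfSize : ∀ {n} → Graph n → ℕ → Set
HasPackingOfSize G k = ∃ λ ts → length ts ≡ k × IsPacking G ts

HasCoverOfSize : ∀ {n} → Graph n → ℕ → Set
HasCoverOfSize G k = ∃ λ Y → length Y ≡ k × IsCover G Y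

IsMaximum IsMinimum : Pred ℕ 0ℓ → ℕ → Set
IsMaximum P m = P m × (∀ {k} → P k → k ≤ m)
IsMinimum P m = P m × (∀ {k} → P k → m ≤ k)

------------------------------------------------------------------------
-- Existence of the maximum and of the minimum

maximum : ∀ {P : Pred ℕ 0ℓ} → Decidable P → P 0 →
          ∀ b → (∀ {k} → P k → k ≤ b) → ∃ (IsMaximum P)
maximum P? p₀ zero    bd = 0 , p₀ , bd
maximum P? p₀ (suc b) bd with P? (suc b)
... | yes p = suc b , p , bd
... | no ¬p = maximum P? p₀ b λ pk →
  ℕ.s≤s⁻¹ (ℕ.≤∧≢⇒< (bd pk) λ { refl → ¬p pk })

minimum : ∀ {P : Pred ℕ 0ℓ} → Decidable P → ∀ m → P m → ∃ (IsMinimum P)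
minimum         P? zero    p = 0 , p , λ _ → z≤n
minimum {P = P} P? (suc m) p with P? 0
... | yes p₀ = 0 , p₀ , λ _ → z≤n
... | no ¬p₀ with minimum (P? ∘ suc) m p
...   | l , pl , least = suc l , pl , bound
  where
  bound : ∀ {k} → P k → suc l ≤ k
  bound {zero}  p₀ = contradiction p₀ ¬p₀
  bound {suc k} pk = ℕ.s≤s (least pk)

Searchable : Set → Set₁
Searchable A = ∀ {P : Pred A 0ℓ} → Decidable P → Dec (∃ P)

search-× : ∀ {A B} → Searchable A → Searchable B → Searchable (A × B)
search-× sA sB P? =
  map′ (λ (a , b , p) → (a , b) , p) (λ ((a , b) , p) → a , b , p)
       (sA λ a → sB λ b → P? (a , b))

searchPair : ∀ {n} → Searchable (Pair n)
searchPair = search-× any? any?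

searchTriple : ∀ {n} → Searchable (Triple n)
searchTriple = search-× any? searchPair

searchList : ∀ {A} → Searchable A → ∀ k {P : Pred (List A) 0ℓ} →
             Decidable P → Dec (∃ λ xs → length xs ≡ k × P xs)
searchList sA zero    P? =
  map′ (λ p → [] , refl , p) (λ { ([] , _ , p) → p }) (P? [])
searchList sA (suc k) P? =
  map′ (λ { (x , xs , eq , p) → x ∷ xs , cong suc eq , p })
       (λ { (x ∷ xs , eq , p) → x , xs , ℕ.suc-injective eq , p })
       (sA λ x → searchList sA k (P? ∘ (x ∷_)))

module _ {n} (G : Graph n) where

  open DecMembership (_≟ᵖ_ {n}) using (_∈?_)

  isEdge? : Decidable (IsEdge G)
  isEdge? (u , v) = u <? v ×-dec adj? G u v

  isTriangle? : Decidable (IsTriangle G)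
  isTriangle? (a , b , c) =
    a <? b ×-dec b <? c ×-dec adj? G a b ×-dec adj? G b c ×-dec adj? G a c

  edgeDisjoint? : Binary.Decidable (EdgeDisjoint {n})
  edgeDisjoint? s t =
    map′ (λ al (p , q) → All.lookup al p q) (λ d → All.tabulate λ p q → d (p , q))
         (All.all? (λ e → ¬? (e ∈? triangleEdges t)) (triangleEdges s))

  isPacking? : Decidable (IsPacking G)
  isPacking? ts = All.all? isTriangle? ts ×-dec AllPairs.allPairs? edgeDisjoint? ts

triangleFree? : ∀ {n} (G : Graph n) → Dec (TriangleFree G)
triangleFree? G =
  map′ (λ ¬∃ t p → ¬∃ (t , p)) (λ f (t , p) → f t p) (¬? (searchTriple (isTriangle? G)))

isCover? : ∀ {n} (G : Graph n) → Decidable (IsCover G)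
isCover? G Y =
  All.all? (isEdge? G) Y ×-dec DecUnique.unique? _≟ᵖ_ Y ×-dec triangleFree? (G -ᵉ Y)

firstEdge : ∀ {n} → Triple n → Fin (n ℕ.* n)
firstEdge (a , b , _) = combine a b

edgeDisjoint⇒firstEdge≢ : ∀ {n} {s t : Triple n} → EdgeDisjoint s t → firstEdge s ≢ firstEdge t
edgeDisjoint⇒firstEdge≢ {s = a , b , _} {c , d , _} dis eq
  with refl , refl ← combine-injective a b c d eq = dis (here refl , here refl)

firstEdge-injective : ∀ {n} {ts : List (Triple n)} → AllPairs EdgeDisjoint ts →
                      Injective _≡_ _≡_ (firstEdge ∘ lookup ts)
firstEdge-injective {ts = _ ∷ ts} (ds ∷ ps) {Fin.zero}  {Fin.zero}  eq = refl
firstEdge-injective {ts = _ ∷ ts} (ds ∷ ps) {Fin.zero}  {Fin.suc j} eq =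
  contradiction eq (edgeDisjoint⇒firstEdge≢ (All.lookup ds (∈-lookup j)))
firstEdge-injective {ts = _ ∷ ts} (ds ∷ ps) {Fin.suc i} {Fin.zero}  eq =
  contradiction (sym eq) (edgeDisjoint⇒firstEdge≢ (All.lookup ds (∈-lookup i)))
firstEdge-injective {ts = _ ∷ ts} (ds ∷ ps) {Fin.suc i} {Fin.suc j} eq =
  cong Fin.suc (firstEdge-injective ps eq)

module _ {n} (G : Graph n) where

  ∃-maximumPacking : ∃ (IsMaximum (HasPackingOfSize G))
  ∃-maximumPacking =
    maximum (λ k → searchList searchTriple k (isPacking? G)) ([] , refl , [] , [])
            (n ℕ.* n) λ { (_ , refl , _ , ps) → injective⇒≤ (firstEdge-injective ps) }

  allEdges : List (Pair n)
  allEdges = filter (isEdge? G) (cartesianProduct (allFin n) (allFin n))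

  allEdges-cover : IsCover G allEdges
  allEdges-cover =
    all-filter (isEdge? G) (cartesianProduct (allFin n) (allFin n)) ,
    Unique.filter⁺ (isEdge? G) (Unique.cartesianProduct⁺ (Unique.allFin⁺ n) (Unique.allFin⁺ n)) ,
    λ { (a , b , c) (a<b , _ , (ab , ∉Y , _) , _) →
        ∉Y (∈-filter⁺ (isEdge? G) (∈-cartesianProduct⁺ (∈-allFin a) (∈-allFin b)) (a<b , ab)) }

  ∃-minimumCover : ∃ (IsMinimum (HasCoverOfSize G))
  ∃-minimumCover =
    minimum (λ k → searchList searchPair k (isCover? G)) _ (allEdges , refl , allEdges-cover)

  ν : ℕ
  ν = proj₁ ∃-maximumPacking

  ν-isMaximum : IsMaximum (HasPackingOfSize G) ν
  ν-isMaximum = proj₂ ∃-maximumPacking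

  τ : ℕ
  τ = proj₁ ∃-minimumCover

  τ-isMinimum : IsMinimum (HasCoverOfSize G) τ
  τ-isMinimum = proj₂ ∃-minimumCover

{-# OPTIONS --safe #-}
module Submission where

open import Defs
open import Data.Bool.Base using (Bool; true; false; not; _∧_; _∨_; if_then_else_)
open import Data.Empty using (⊥; ⊥-elim)
open import Data.Fin.Base using (Fin; zero; suc; toℕ; fromℕ; _<_)
open import Data.Fin.Patterns using (0F; 1F; 2F; 3F)
import Data.Fin.Properties as Fin
open import Data.List.Base
  using (List; []; _∷_; _++_; _∷ʳ_; [_]; length; reverse; lookup; map; filter; deduplicate; allFin;
         concatMap; initLast; _∷ʳ′_)
open import Data.List.Membership.Propositional using (_∈_; _∉_; find; lose)
open import Data.List.Membership.Propositional.Properties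
  using (∈-++⁺ˡ; ∈-++⁺ʳ; ∈-++⁻; ∈-∃++; ∈-lookup; ∈-filter⁺; ∈-filter⁻; ∈-cartesianProduct⁺; ∈-allFin;
         ∈-map⁺; ∈-deduplicate⁺; ∈-deduplicate⁻; ∈-concatMap⁺; ∈-concatMap⁻)
import Data.List.Membership.DecPropositional as DecMembership
open import Data.List.Properties
  using (unfold-reverse; reverse-++; ++-assoc; length-++; length-reverse; length-map; length-filter;
         length-deduplicate)
open import Data.List.Relation.Binary.Disjoint.Propositional using (Disjoint)
open import Data.List.Relation.Binary.Permutation.Propositional
  using (_↭_; refl; prep; swap; trans; ↭-sym; ↭-trans; ↭-reflexive)
open import Data.List.Relation.Binary.Permutation.Propositional.Properties
  using (∈-resp-↭; All-resp-↭; Any-resp-↭; ++⁺ˡ; ++⁺ʳ; ++-comm; shift; ↭-reverse; ↭-length)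
open import Data.List.Relation.Binary.Subset.Propositional using (_⊆_)
open import Data.List.Relation.Unary.All as All using (All; []; _∷_)
open import Data.List.Relation.Unary.All.Properties as All using (¬Any⇒All¬; All¬⇒¬Any)
open import Data.List.Relation.Unary.AllPairs as AllPairs using (AllPairs; []; _∷_)
import Data.List.Relation.Unary.AllPairs.Properties as AllPairs
open import Data.List.Relation.Unary.Any as Any using (here; there)
open import Data.List.Relation.Unary.Linked as Linked using (Linked; []; [-]; _∷_)
open import Data.List.Relation.Unary.Unique.Propositional using (Unique)
open import Data.List.Relation.Unary.Unique.DecPropositional.Properties using (deduplicate-!)
import Data.List.Relation.Unary.Unique.Propositional.Properties as Unique
open import Data.Nat.Base as ℕ using (ℕ; zero; suc; _+_; _*_; _≤_; z≤n; s≤s; z<s; s<s)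
import Data.Nat.Properties as ℕ
open import Data.Nat.Tactic.RingSolver using (solve-∀)
open import Data.Product.Base as Product using (∃; ∃₂; _×_; _,_; proj₁; proj₂)
open import Data.Sum.Base as Sum using (_⊎_; inj₁; inj₂; [_,_]′)
open import Data.Vec.Base as Vec using (Vec; []; _∷_)
open import Function.Base using (_∘_; id)
open import Function.Definitions using (Injective)
open import Level using (0ℓ)
open import Relation.Binary.Core using (Rel)
open import Relation.Binary.Definitions as Binary using (Symmetric; tri<; tri≈; tri>)
open import Relation.Binary.PropositionalEquality as ≡
  using (_≡_; _≢_; refl; sym; cong; subst; ≢-sym)
open import Relation.Nullary.Decidable
  using (Dec; yes; no; map′; ¬?; _×-dec_; _⊎-dec_; _→-dec_; from-yes)
open import Relation.Nullary.Negation using (¬_; contradiction)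

-- Delete one vertex v at a time.  The neighbourhood L of v contains no subdivision of K₄, because v
-- would complete it to a subdivision of K₅.  Such an L has a matching M and a vertex set C with
-- |C| ≤ |M| such that every edge of L lies in M or meets C.  The triangles spanned by v and the
-- edges of M are then edge-disjoint, and the edges in M together with those from v to C, at most
-- 2|M| in number, meet every triangle at v; after deleting v and M one continues by induction.
--
-- To find M and C, cut L into two-terminal pieces, initially its edges, and merge pieces that are
-- parallel, in series, or pendant.  A piece is summarised by the surplus |M| − |C| it guarantees
-- for each behaviour at its terminals.  Up to domination only eleven such summaries occur, so each
-- merging rule is a finite check.  If no rule applies, the pieces form a simple graph of minimum
-- degree three, which contains a subdivision of K₄ by Dirac's theorem, and so does L.

-- Some restriction on L is unavoidable: in K₅ a matching has at most two edges, and two cover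
-- vertices leave a triangle whose three edges cannot all lie in M. It also matters that M covers
-- its own edges: a triangle has a matching of size one, but no vertex cover of size one.
--
-- M and C cannot be chosen in each piece separately. A shared terminal may be matched in one piece
-- only, and if it is in the cover it is paid for once. A table over the states of both terminals
-- records all that a merge has to know. Its entries are lower bounds, so a merged piece may be
-- filed under any weaker table; this is how so few tables suffice.
--
-- Each piece also carries a path between its terminals. These paths turn a subdivision of K₄ among
-- the pieces into one in L.

-- Lists: repetition, disjointness, linked lists and their reversal

module _ {A : Set} where

  private variable
    x y z : A
    xs ys : List A

  ∉⇒All≢ : x ∉ xs → All (x ≢_) xs
  ∉⇒All≢ = ¬Any⇒All¬ _

  All≢⇒∉ : All (x ≢_) xs → x ∉ xs
  All≢⇒∉ = All¬⇒¬Any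

  unique-++⁻ : ∀ xs → Unique (xs ++ ys) → Unique xs × Unique ys × Disjoint xs ys
  unique-++⁻ []       u        = [] , u , λ ()
  unique-++⁻ (x ∷ xs) (x∉ ∷ u) with unique-++⁻ xs u
  ... | uxs , uys , dis =
    ∉⇒All≢ (All≢⇒∉ x∉ ∘ ∈-++⁺ˡ) ∷ uxs , uys ,
    λ { (here refl , q) → All≢⇒∉ x∉ (∈-++⁺ʳ xs q) ; (there p , q) → dis (p , q) }

  allPairs-resp-↭ : {R : Rel A 0ℓ} → Symmetric R → xs ↭ ys → AllPairs R xs → AllPairs R ys
  allPairs-resp-↭ s refl         ps                   = ps
  allPairs-resp-↭ s (prep x σ)   (p ∷ ps)             = All-resp-↭ σ p ∷ allPairs-resp-↭ s σ ps
  allPairs-resp-↭ s (swap x y σ) ((p ∷ ps) ∷ qs ∷ rs) =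
    (s p ∷ All-resp-↭ σ qs) ∷ All-resp-↭ σ ps ∷ allPairs-resp-↭ s σ rs
  allPairs-resp-↭ s (trans σ τ)  ps                   =
    allPairs-resp-↭ s τ (allPairs-resp-↭ s σ ps)

  unique-resp-↭ : xs ↭ ys → Unique xs → Unique ys
  unique-resp-↭ = allPairs-resp-↭ ≢-sym

  disjoint-sym : Disjoint xs ys → Disjoint ys xs
  disjoint-sym d (p , q) = d (q , p)

  module _ {R : Rel A 0ℓ} where

    linked-++ : ∀ xs → Linked R (xs ∷ʳ z) → Linked R (z ∷ ys) → Linked R (xs ++ z ∷ ys)
    linked-++ []           _       k = k
    linked-++ (x ∷ [])     (r ∷ _) k = r ∷ k
    linked-++ (x ∷ y ∷ xs) (r ∷ l) k = r ∷ linked-++ (y ∷ xs) l k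

    linked-++⁻ˡ : ∀ xs → Linked R (xs ++ z ∷ ys) → Linked R (xs ∷ʳ z)
    linked-++⁻ˡ []           _       = [-]
    linked-++⁻ˡ (x ∷ [])     (r ∷ _) = r ∷ [-]
    linked-++⁻ˡ (x ∷ y ∷ xs) (r ∷ l) = r ∷ linked-++⁻ˡ (y ∷ xs) l

    linked-++⁻ʳ : ∀ xs → Linked R (xs ++ ys) → Linked R ys
    linked-++⁻ʳ []       l = l
    linked-++⁻ʳ (x ∷ xs) l = linked-++⁻ʳ xs (Linked.tail l)

    linked-reverse : Symmetric R → ∀ xs → Linked R xs → Linked R (reverse xs)
    linked-reverse s []           l       = []
    linked-reverse s (x ∷ [])     l       = [-]
    linked-reverse s (x ∷ y ∷ xs) (r ∷ l) =
      subst (Linked R) (sym (≡.trans (unfold-reverse x (y ∷ xs))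
        (≡.trans (cong (_∷ʳ x) (unfold-reverse y xs)) (++-assoc (reverse xs) [ y ] [ x ]))))
        (linked-++ (reverse xs)
          (subst (Linked R) (unfold-reverse y xs) (linked-reverse s (y ∷ xs) l))
          (s r ∷ [-]))

    linked-all : {P : A → Set} → (∀ {u v} → R u v → P u × P v) →
                 Linked R (x ∷ y ∷ xs) → All P (x ∷ y ∷ xs)
    linked-all f (r ∷ [-])        = proj₁ (f r) ∷ proj₂ (f r) ∷ []
    linked-all f (r ∷ l@(_ ∷ _)) = proj₁ (f r) ∷ linked-all f l

  reverse-path : ∀ (x : A) xs y → reverse (x ∷ xs ∷ʳ y) ≡ y ∷ reverse xs ∷ʳ x
  reverse-path x xs y = ≡.trans (unfold-reverse x (xs ∷ʳ y)) (cong (_∷ʳ x) (reverse-++ xs [ y ]))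

  data Inner? (x : A) (xs : List A) (y : A) (z : A) : Set where
    isˡ : z ≡ x → Inner? x xs y z
    isⁱ : z ∈ xs → Inner? x xs y z
    isʳ : z ≡ y → Inner? x xs y z

  inner? : ∀ xs → z ∈ x ∷ xs ∷ʳ y → Inner? x xs y z
  inner? xs (here refl) = isˡ refl
  inner? xs (there p) with ∈-++⁻ xs p
  ... | inj₁ q           = isⁱ q
  ... | inj₂ (here refl) = isʳ refl

-- Topological minors

-- IsSubdivision without the subgraph, which is the union of the paths.

record TopMinor {k n} (K : Graph k) (G : Graph n) : Set where
  field
    branch           : Fin k → Fin n
    branch-injective : Injective _≡_ _≡_ branch
    inner            : Pair k → List (Fin n)

  path : Pair k → List (Fin n)
  path (i , j) = branch i ∷ inner (i , j) ++ branch j ∷ []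

  field
    path-linked    : ∀ {e} → IsEdge K e → Linked (Adj G) (path e)
    path-unique    : ∀ {e} → IsEdge K e → Unique (path e)
    inner∌branch   : ∀ {e} → IsEdge K e → ∀ i → branch i ∉ inner e
    inner-disjoint : ∀ {e f} → IsEdge K e → IsEdge K f → e ≢ f →
                     Disjoint (inner e) (inner f)

consecutive-∷ : ∀ {A : Set} {u v x : A} {xs} → Consecutive u v xs → Consecutive u v (x ∷ xs)
consecutive-∷ (ps , qs , refl) = _ ∷ ps , qs , refl

linked-consecutive : ∀ {A : Set} (xs : List A) → Linked (λ u v → Consecutive u v xs) xs
linked-consecutive []           = []
linked-consecutive (x ∷ [])     = [-]
linked-consecutive (x ∷ y ∷ xs) =
  ([] , xs , refl) ∷ Linked.map consecutive-∷ (linked-consecutive (y ∷ xs))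

consecutive-linked : ∀ {A : Set} {R : Rel A 0ℓ} {u v xs} → Linked R xs → Consecutive u v xs → R u v
consecutive-linked l (ps , qs , refl) = Linked.head (linked-++⁻ʳ ps l)

topMinor⇒subdivision : ∀ {k n} {K : Graph k} {G : Graph n} → TopMinor K G → ContainsSubdivision K G
topMinor⇒subdivision {K = K} {G} t = H , record
  { branch           = branch
  ; branch-injective = branch-injective
  ; branch-vertex    = λ i → inj₁ (i , refl)
  ; inner            = inner
  ; path-linked      = λ {e} ke →
      Linked.map (λ c → e , ke , inj₁ c) (linked-consecutive (path e))
  ; path-unique      = path-unique
  ; inner∌branch     = inner∌branch
  ; inner-disjoint   = inner-disjoint
  -- `V` and the adjacency of `H` are chosen to be the conclusions of the two covering conditions.
  ; cover-vertices   = id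
  ; cover-edges      = id
  }
  where
  open TopMinor t
  V : Fin _ → Set
  V v = (∃ λ i → v ≡ branch i) ⊎ (∃ λ e → IsEdge K e × v ∈ inner e)

  on-path : ∀ {e v} → IsEdge K e → v ∈ path e → V v
  on-path {i , j} ke p with inner? (inner (i , j)) p
  ... | isˡ q = inj₁ (i , q)
  ... | isⁱ q = inj₂ (_ , ke , q)
  ... | isʳ q = inj₁ (j , q)

  ends : ∀ {e u v} → IsEdge K e → Consecutive u v (path e) → V u × V v
  ends ke (ps , qs , eq) =
    on-path ke (subst (_ ∈_) (sym eq) (∈-++⁺ʳ ps (here refl))) ,
    on-path ke (subst (_ ∈_) (sym eq) (∈-++⁺ʳ ps (there (here refl))))

  H : Subgraph G
  H = record
    { Vertex = V
    ; Adjˢ   = λ u v → ∃ λ e → IsEdge K e × (Consecutive u v (path e) ⊎ Consecutive v u (path e))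
    ; symmˢ  = λ (e , ke , c) → e , ke , Sum.swap c
    ; inside = λ { (e , ke , inj₁ c) → consecutive-linked (path-linked ke) c
                 ; (e , ke , inj₂ c) → symm G (consecutive-linked (path-linked ke) c) }
    ; endsˢ  = λ { (e , ke , inj₁ c) → ends ke c
                 ; (e , ke , inj₂ c) → Product.swap (ends ke c) }
    }

-- Replacing the edges of a graph by paths

-- Both graphs live on `Fin n`, so "not a vertex of `H`" is rendered as "isolated in `H`", which is
-- `inn-fresh`. The lists `inn y z` and `inn z y` may come from the same path, so an inner vertex
-- determines its edge only up to reversal.
record Expansion {n} (H G : Graph n) : Set where
  field
    inn          : Fin n → Fin n → List (Fin n)
    inn-linked   : ∀ {y z} → Adj H y z → Linked (Adj G) (y ∷ inn y z ∷ʳ z)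
    inn-unique   : ∀ {y z} → Adj H y z → Unique (inn y z)
    inn-fresh    : ∀ {y z u w} → Adj H y z → u ∈ inn y z → ¬ Adj H u w
    inn-disjoint : ∀ {y z y′ z′ u} → Adj H y z → Adj H y′ z′ → u ∈ inn y z → u ∈ inn y′ z′ →
                   (y ≡ y′ × z ≡ z′) ⊎ (y ≡ z′ × z ≡ y′)

module _ {n} {H G : Graph n} (X : Expansion H G) where

  open Expansion X

  private
    V = Fin n

    HasNeighbour : V → Set
    HasNeighbour v = ∃ (Adj H v)

    nbrs : ∀ {x y xs} → Linked (Adj H) (x ∷ y ∷ xs) → All HasNeighbour (x ∷ y ∷ xs)
    nbrs = linked-all λ r → (_ , r) , (_ , symm H r)

    path-nbrs : ∀ {a} s {b} → Linked (Adj H) (a ∷ s ∷ʳ b) → All HasNeighbour (a ∷ s ∷ʳ b)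
    path-nbrs []      l = nbrs l
    path-nbrs (_ ∷ _) l = nbrs l

  expand : V → List V → V → List V
  expand a []      b = inn a b
  expand a (c ∷ s) b = inn a c ++ c ∷ expand c s b

  expand-linked : ∀ a s {b} → Linked (Adj H) (a ∷ s ∷ʳ b) → Linked (Adj G) (a ∷ expand a s b ∷ʳ b)
  expand-linked a []      (h ∷ _) = inn-linked h
  expand-linked a (c ∷ s) {b} (h ∷ l) =
    subst (Linked (Adj G)) (cong (a ∷_) (sym (++-assoc (inn a c) (c ∷ expand c s b) [ b ])))
      (linked-++ (a ∷ inn a c) (inn-linked h) (expand-linked c s l))

  expand-∈ : ∀ a s {b u} → Linked (Adj H) (a ∷ s ∷ʳ b) → u ∈ expand a s b →
             u ∈ s ⊎ ∃₂ λ p q → p ∈ a ∷ s ∷ʳ b × q ∈ a ∷ s ∷ʳ b × Adj H p q × u ∈ inn p q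
  expand-∈ a []      (h ∷ _) u∈ = inj₂ (_ , _ , here refl , there (here refl) , h , u∈)
  expand-∈ a (c ∷ s) (h ∷ l) u∈ with ∈-++⁻ (inn a c) u∈
  ... | inj₁ q           = inj₂ (_ , _ , here refl , there (here refl) , h , q)
  ... | inj₂ (here refl) = inj₁ (here refl)
  ... | inj₂ (there q) with expand-∈ c s l q
  ...   | inj₁ r                      = inj₁ (there r)
  ...   | inj₂ (_ , _ , p , q , h′ , r) = inj₂ (_ , _ , there p , there q , h′ , r)

  expand-fresh : ∀ a s {b u} → Linked (Adj H) (a ∷ s ∷ʳ b) → HasNeighbour u →
                 u ∈ expand a s b → u ∈ s
  expand-fresh a s l (_ , h) u∈ with expand-∈ a s l u∈
  ... | inj₁ r                       = r
  ... | inj₂ (_ , _ , _ , _ , h′ , r) = contradiction h (inn-fresh h′ r)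

  -- If an inserted vertex occurs twice, the two edges of `H` agree up to reversal, and then `a`
  -- occurs again later on a path without repetitions.
  expand-unique : ∀ a s {b} → Linked (Adj H) (a ∷ s ∷ʳ b) → Unique (a ∷ s ∷ʳ b) →
                  Unique (expand a s b)
  expand-unique a []      (h ∷ _) _ = inn-unique h
  expand-unique a (c ∷ s) {b} (h ∷ l) (a∉ ∷ uq@(c∉ ∷ _)) =
    Unique.++⁺ (inn-unique h) (∉⇒All≢ c∉ex ∷ expand-unique c s l uq) dis
    where
    nb = path-nbrs s l
    c∉ex : c ∉ expand c s b
    c∉ex p = All≢⇒∉ c∉ (∈-++⁺ˡ (expand-fresh c s l (All.head nb) p))
    dis : Disjoint (inn a c) (c ∷ expand c s b)
    dis (p , here refl) = inn-fresh h p (symm H h)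
    dis (p , there q) with expand-∈ c s l q
    ... | inj₁ r = inn-fresh h p (proj₂ (All.lookup nb (there (∈-++⁺ˡ r))))
    ... | inj₂ (_ , _ , y∈ , z∈ , h′ , r) with inn-disjoint h h′ p r
    ...   | inj₁ (refl , _) = All≢⇒∉ a∉ y∈
    ...   | inj₂ (refl , _) = All≢⇒∉ a∉ z∈

  -- The image of an isolated vertex of `K` could be an inner vertex of an inserted path. `isolated`
  -- excludes this: every branch vertex ends a path, so it has a neighbour in `H` and avoids all
  -- inserted lists.
  module _ {k} {K : Graph k} (t : TopMinor K H)
           (isolated : ∀ i → ∃ λ j → IsEdge K (i , j) ⊎ IsEdge K (j , i)) where

    open TopMinor t

    private
      branch-nbr : ∀ i → HasNeighbour (branch i)
      branch-nbr i with isolated i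
      ... | j , inj₁ e = All.head (path-nbrs (inner (i , j)) (path-linked e))
      ... | j , inj₂ e =
        All.lookup (path-nbrs (inner (j , i)) (path-linked e)) (there (∈-++⁺ʳ (inner (j , i)) (here refl)))

      inner′ : Pair k → List V
      inner′ (i , j) = expand (branch i) (inner (i , j)) (branch j)

      End : Fin k → Pair k → Set
      End x (i , j) = x ≡ i ⊎ x ≡ j

      -- Inner lists are disjoint and contain no branch vertex, so only ends can be shared.
      common : ∀ {e f} → IsEdge K e → IsEdge K f → e ≢ f → ∀ {p} → p ∈ path e → p ∈ path f →
               ∃ λ x → p ≡ branch x × End x e × End x f
      common {i , j} {i′ , j′} ke kf e≢f p q with inner? (inner (i , j)) p | inner? (inner (i′ , j′)) q
      ... | isˡ refl | isˡ r = i , refl , inj₁ refl , inj₁ (branch-injective r)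
      ... | isˡ refl | isⁱ r = contradiction r (inner∌branch kf i)
      ... | isˡ refl | isʳ r = i , refl , inj₁ refl , inj₂ (branch-injective r)
      ... | isⁱ s    | isˡ refl = contradiction s (inner∌branch ke i′)
      ... | isⁱ s    | isⁱ r = contradiction (s , r) (inner-disjoint ke kf e≢f)
      ... | isⁱ s    | isʳ refl = contradiction s (inner∌branch ke j′)
      ... | isʳ refl | isˡ r = j , refl , inj₂ refl , inj₁ (branch-injective r)
      ... | isʳ refl | isⁱ r = contradiction r (inner∌branch kf j)
      ... | isʳ refl | isʳ r = j , refl , inj₂ refl , inj₂ (branch-injective r)

      -- Edges are increasing pairs, so the two ends cannot appear in opposite order in `e` and `f`.
      same-ends : ∀ {e f} → IsEdge K e → IsEdge K f → ∀ {x y} → x ≢ y →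
                  End x e → End x f → End y e → End y f → e ≡ f
      same-ends ke kf ne (inj₁ refl) _ (inj₁ refl) _ = contradiction refl ne
      same-ends ke kf ne (inj₂ refl) _ (inj₂ refl) _ = contradiction refl ne
      same-ends ke kf ne (inj₁ refl) (inj₁ refl) (inj₂ refl) (inj₁ refl) = contradiction refl ne
      same-ends ke kf ne (inj₁ refl) (inj₁ refl) (inj₂ refl) (inj₂ refl) = refl
      same-ends ke kf ne (inj₁ refl) (inj₂ refl) (inj₂ refl) (inj₁ refl) =
        contradiction (proj₁ kf) (ℕ.<-asym (proj₁ ke))
      same-ends ke kf ne (inj₁ refl) (inj₂ refl) (inj₂ refl) (inj₂ refl) = contradiction refl ne
      same-ends ke kf ne (inj₂ refl) (inj₁ refl) (inj₁ refl) (inj₁ refl) = contradiction refl ne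
      same-ends ke kf ne (inj₂ refl) (inj₁ refl) (inj₁ refl) (inj₂ refl) =
        contradiction (proj₁ kf) (ℕ.<-asym (proj₁ ke))
      same-ends ke kf ne (inj₂ refl) (inj₂ refl) (inj₁ refl) (inj₁ refl) = refl
      same-ends ke kf ne (inj₂ refl) (inj₂ refl) (inj₁ refl) (inj₂ refl) = contradiction refl ne

      -- A vertex inserted in both expansions belongs to a single edge of `H`, whose two ends then
      -- lie on both paths. By `common` they are two distinct common ends of `e` and `f`.
      disjoint′ : ∀ {e f} → IsEdge K e → IsEdge K f → e ≢ f → Disjoint (inner′ e) (inner′ f)
      disjoint′ {i , j} {i′ , j′} ke kf e≢f (p , q)
        with expand-∈ _ (inner (i , j)) (path-linked ke) p | expand-∈ _ (inner (i′ , j′)) (path-linked kf) q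
      ... | inj₁ r | inj₁ s = inner-disjoint ke kf e≢f (r , s)
      ... | inj₁ r | inj₂ (_ , _ , _ , _ , h , s) =
        inn-fresh h s (proj₂ (All.lookup (path-nbrs (inner (i , j)) (path-linked ke)) (there (∈-++⁺ˡ r))))
      ... | inj₂ (_ , _ , _ , _ , h , s) | inj₁ r =
        inn-fresh h s (proj₂ (All.lookup (path-nbrs (inner (i′ , j′)) (path-linked kf)) (there (∈-++⁺ˡ r))))
      ... | inj₂ (a , b , a∈ , b∈ , h , r) | inj₂ (_ , _ , c∈ , d∈ , h′ , s) =
        [ (λ { (refl , refl) → clash c∈ d∈ }) , (λ { (refl , refl) → clash d∈ c∈ }) ]′ (inn-disjoint h h′ r s)
        where
        clash : a ∈ path (i′ , j′) → b ∈ path (i′ , j′) → ⊥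
        clash a∈′ b∈′ with common ke kf e≢f a∈ a∈′ | common ke kf e≢f b∈ b∈′
        ... | x , refl , xe , xf | y , refl , ye , yf =
          e≢f (same-ends ke kf (λ { refl → irrefl H refl h }) xe xf ye yf)

    expandMinor : TopMinor K G
    expandMinor = record
      { branch           = branch
      ; branch-injective = branch-injective
      ; inner            = inner′
      ; path-linked      = λ {e} ke → expand-linked _ (inner e) (path-linked ke)
      ; path-unique      = unique
      ; inner∌branch     = λ {e} ke i p →
          inner∌branch ke i (expand-fresh _ (inner e) (path-linked ke) (branch-nbr i) p)
      ; inner-disjoint   = disjoint′
      }
      where
      unique : ∀ {e} → IsEdge K e → Unique (branch (proj₁ e) ∷ inner′ e ∷ʳ branch (proj₂ e))
      unique {e@(i , j)} ke with path-unique ke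
      ... | i∉ ∷ u = ∉⇒All≢ i∉′ ∷
        Unique.++⁺ (expand-unique _ (inner e) (path-linked ke) (path-unique ke)) ([] ∷ [])
          λ { (p , here refl) → inner∌branch ke j (expand-fresh _ (inner e) (path-linked ke) (branch-nbr j) p) }
        where
        i∉′ : branch i ∉ inner′ e ∷ʳ branch j
        i∉′ p with ∈-++⁻ (inner′ e) p
        ... | inj₁ q = inner∌branch ke i (expand-fresh _ (inner e) (path-linked ke) (branch-nbr i) q)
        ... | inj₂ (here eq) = All≢⇒∉ i∉ (∈-++⁺ʳ (inner e) (here eq))

-- Dirac's theorem: a graph of minimum degree three contains a subdivision of K₄

lookup-injective : ∀ {A : Set} {xs : List A} → Unique xs → Injective _≡_ _≡_ (lookup xs)
lookup-injective (x∉ ∷ u) {zero}  {zero}  eq = refl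
lookup-injective (x∉ ∷ u) {zero}  {suc j} eq = contradiction eq (All.lookup x∉ (∈-lookup j))
lookup-injective (x∉ ∷ u) {suc i} {zero}  eq = contradiction (sym eq) (All.lookup x∉ (∈-lookup i))
lookup-injective (x∉ ∷ u) {suc i} {suc j} eq = cong suc (lookup-injective u eq)

unique-length : ∀ {n} {xs : List (Fin n)} → Unique xs → length xs ≤ n
unique-length u = Fin.injective⇒≤ (lookup-injective u)

K₄-edges : (P : Pair 4 → Set) → P (0F , 1F) → P (0F , 2F) → P (0F , 3F) →
           P (1F , 2F) → P (1F , 3F) → P (2F , 3F) → ∀ {e} → IsEdge (complete 4) e → P e
K₄-edges P a b c d e f {0F , 0F} (() , _)
K₄-edges P a b c d e f {0F , 1F} _ = a
K₄-edges P a b c d e f {0F , 2F} _ = b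
K₄-edges P a b c d e f {0F , 3F} _ = c
K₄-edges P a b c d e f {1F , 0F} (() , _)
K₄-edges P a b c d e f {1F , 1F} (s<s () , _)
K₄-edges P a b c d e f {1F , 2F} _ = d
K₄-edges P a b c d e f {1F , 3F} _ = e
K₄-edges P a b c d e f {2F , 0F} (() , _)
K₄-edges P a b c d e f {2F , 1F} (s<s () , _)
K₄-edges P a b c d e f {2F , 2F} (s<s (s<s ()) , _)
K₄-edges P a b c d e f {2F , 3F} _ = f
K₄-edges P a b c d e f {3F , 0F} (() , _)
K₄-edges P a b c d e f {3F , 1F} (s<s () , _)
K₄-edges P a b c d e f {3F , 2F} (s<s (s<s ()) , _)
K₄-edges P a b c d e f {3F , 3F} (s<s (s<s (s<s ())) , _)

K₄-isolated : ∀ i → ∃ λ j → IsEdge (complete 4) (i , j) ⊎ IsEdge (complete 4) (j , i)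
K₄-isolated zero    = suc zero , inj₁ (z<s , λ ())
K₄-isolated (suc i) = zero , inj₂ (z<s , λ ())

module _ {n} (H : Graph n) where

  private
    V = Fin n

  -- The shape that a lasso yields: ac, bc and ad are edges, and only the other three paths may have
  -- inner vertices.
  module _ {a b c d : V} {s q p : List V}
           (ac : Adj H a c) (bc : Adj H b c) (ad : Adj H a d)
           (ab : Linked (Adj H) (a ∷ s ∷ʳ b)) (bd : Linked (Adj H) (b ∷ q ∷ʳ d))
           (cd : Linked (Adj H) (c ∷ p ∷ʳ d))
           (unique : Unique ((a ∷ b ∷ c ∷ d ∷ []) ++ s ++ q ++ p)) where

    private
      branch : Fin 4 → V
      branch = lookup (a ∷ b ∷ c ∷ d ∷ [])

      inner : Pair 4 → List V
      inner (0F , 1F) = s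
      inner (1F , 3F) = q
      inner (2F , 3F) = p
      inner _         = []

      split₁ = unique-++⁻ (a ∷ b ∷ c ∷ d ∷ []) unique
      split₂ = unique-++⁻ s (proj₁ (proj₂ split₁))
      split₃ = unique-++⁻ q (proj₁ (proj₂ split₂))

      fresh : ∀ i → branch i ∉ s ++ q ++ p
      fresh i m = proj₂ (proj₂ split₁) (∈-lookup i , m)

      distinct : Injective _≡_ _≡_ branch
      distinct = lookup-injective (proj₁ split₁)

      Located : V → Pair 4 → Set
      Located u e = (e ≡ (0F , 1F) × u ∈ s) ⊎ (e ≡ (1F , 3F) × u ∈ q) ⊎ (e ≡ (2F , 3F) × u ∈ p)

      located : ∀ {u e} → IsEdge (complete 4) e → u ∈ inner e → Located u e
      located {u} = K₄-edges (λ e → u ∈ inner e → Located u e)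
        (λ m → inj₁ (refl , m)) (λ ()) (λ ()) (λ ())
        (λ m → inj₂ (inj₁ (refl , m))) (λ m → inj₂ (inj₂ (refl , m)))

      inner⊆ : ∀ {u e} → Located u e → u ∈ s ++ q ++ p
      inner⊆ (inj₁ (_ , m))        = ∈-++⁺ˡ m
      inner⊆ (inj₂ (inj₁ (_ , m))) = ∈-++⁺ʳ s (∈-++⁺ˡ m)
      inner⊆ (inj₂ (inj₂ (_ , m))) = ∈-++⁺ʳ s (∈-++⁺ʳ q m)

      clash : ∀ {u e f} → e ≢ f → Located u e → Located u f → ⊥
      clash ne (inj₁ (refl , _)) (inj₁ (refl , _)) = ne refl
      clash ne (inj₁ (_ , m)) (inj₂ (inj₁ (_ , k))) = proj₂ (proj₂ split₂) (m , ∈-++⁺ˡ k)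
      clash ne (inj₁ (_ , m)) (inj₂ (inj₂ (_ , k))) = proj₂ (proj₂ split₂) (m , ∈-++⁺ʳ q k)
      clash ne (inj₂ (inj₁ (refl , _))) (inj₂ (inj₁ (refl , _))) = ne refl
      clash ne (inj₂ (inj₁ (_ , m))) (inj₂ (inj₂ (_ , k))) = proj₂ (proj₂ split₃) (m , k)
      clash ne (inj₂ (inj₂ (refl , _))) (inj₂ (inj₂ (refl , _))) = ne refl
      clash ne (inj₂ (inj₁ (_ , k))) (inj₁ (_ , m)) = proj₂ (proj₂ split₂) (m , ∈-++⁺ˡ k)
      clash ne (inj₂ (inj₂ (_ , k))) (inj₁ (_ , m)) = proj₂ (proj₂ split₂) (m , ∈-++⁺ʳ q k)
      clash ne (inj₂ (inj₂ (_ , k))) (inj₂ (inj₁ (_ , m))) = proj₂ (proj₂ split₃) (m , k)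

      unique-path : ∀ i j {xs} → i ≢ j → Unique xs → (∀ {u} → u ∈ xs → u ∈ s ++ q ++ p) →
                    Unique (branch i ∷ xs ∷ʳ branch j)
      unique-path i j {xs} i≢j u ⊆ =
        ∉⇒All≢ (λ m → [ fresh i ∘ ⊆ , (λ { (here eq) → i≢j (distinct eq) }) ]′ (∈-++⁻ xs m)) ∷
        Unique.++⁺ u ([] ∷ []) λ { (m , here refl) → fresh j (⊆ m) }

    K₄-minor : TopMinor (complete 4) H
    K₄-minor = record
      { branch           = branch
      ; branch-injective = distinct
      ; inner            = inner
      ; path-linked      = K₄-edges (λ e → Linked (Adj H) (branch (proj₁ e) ∷ inner e ∷ʳ branch (proj₂ e)))
          ab (ac ∷ [-]) (ad ∷ [-]) (bc ∷ [-]) bd cd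
      ; path-unique      = K₄-edges (λ e → Unique (branch (proj₁ e) ∷ inner e ∷ʳ branch (proj₂ e)))
          (unique-path 0F 1F (λ ()) (proj₁ split₂) ∈-++⁺ˡ)
          (unique-path 0F 2F (λ ()) [] λ ())
          (unique-path 0F 3F (λ ()) [] λ ())
          (unique-path 1F 2F (λ ()) [] λ ())
          (unique-path 1F 3F (λ ()) (proj₁ split₃) (∈-++⁺ʳ s ∘ ∈-++⁺ˡ))
          (unique-path 2F 3F (λ ()) (proj₁ (proj₂ split₃)) (∈-++⁺ʳ s ∘ ∈-++⁺ʳ q))
      ; inner∌branch     = λ ke i m → fresh i (inner⊆ (located ke m))
      ; inner-disjoint   = λ ke kf ne (m , k) → clash ne (located ke m) (located kf k)
      }

  -- Here a s b c is a cycle with the tail post attached at c, so traversing a s b backwards gives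
  -- another lasso.

  record Lasso (a : V) (s : List V) (b c : V) (post : List V) : Set where
    field
      linked : Linked (Adj H) (a ∷ s ++ b ∷ c ∷ post)
      unique : Unique (a ∷ s ++ b ∷ c ∷ post)
      chord  : Adj H a c

  private
    shift-end : ∀ {A : Set} (s : List A) b xs → (s ∷ʳ b) ++ xs ≡ s ++ b ∷ xs
    shift-end s b xs = ++-assoc s [ b ] xs

  lasso-reverse : ∀ {a s b c post} → Lasso a s b c post → Lasso b (reverse s) a c post
  lasso-reverse {a} {s} {b} {c} {post} l = record
    { linked = linked-++ (b ∷ reverse s)
        (subst (Linked (Adj H)) (reverse-path a s b)
          (linked-reverse (symm H) (a ∷ s ∷ʳ b) (linked-++⁻ˡ (a ∷ s) linked)))
        (chord ∷ Linked.tail (linked-++⁻ʳ (a ∷ s) linked))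
    ; unique = unique-resp-↭ (↭-trans (↭-reflexive (cong (a ∷_) (sym (shift-end s b (c ∷ post)))))
        (↭-trans (++⁺ʳ (c ∷ post) (↭-sym (↭-reverse (a ∷ s ∷ʳ b)))) (↭-reflexive eq))) unique
    ; chord  = Linked.head (linked-++⁻ʳ (a ∷ s) linked)
    }
    where
    open Lasso l
    eq : reverse (a ∷ s ∷ʳ b) ++ c ∷ post ≡ b ∷ reverse s ++ a ∷ c ∷ post
    eq = ≡.trans (cong (_++ c ∷ post) (reverse-path a s b)) (cong (b ∷_) (shift-end (reverse s) a (c ∷ post)))

  -- The branch vertices are `a`, `b`, `c` and `j`. The path from `a` to `b` follows `s`, the one
  -- from `c` to `j` follows the tail, and `b` reaches `j` through `m`, running back along the tail
  -- if `m` comes after `j`.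
  lasso-K₄′ : ∀ {a s b c p j p₂ m} → Lasso a s b c (p ++ j ∷ p₂) → Adj H a j →
              m ∈ j ∷ p₂ → Adj H b m → TopMinor (complete 4) H
  lasso-K₄′ {a} {s} {b} {c} {p} {j} {p₂} l aj (here refl) bm =
    K₄-minor {q = []} chord (Linked.head (linked-++⁻ʳ (a ∷ s) linked)) aj
      (linked-++⁻ˡ (a ∷ s) linked) (bm ∷ [-]) (linked-++⁻ˡ (c ∷ p) rest)
      (proj₁ (unique-++⁻ _ (unique-resp-↭ σ unique)))
    where
    open Lasso l
    rest = Linked.tail (linked-++⁻ʳ (a ∷ s) linked)
    σ : a ∷ s ++ b ∷ c ∷ p ++ j ∷ p₂ ↭ ((a ∷ b ∷ c ∷ j ∷ []) ++ s ++ p) ++ p₂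
    σ = prep a (↭-trans (shift b s _) (prep b (↭-trans (shift c s _) (prep c
          (↭-trans (++⁺ˡ s (shift j p p₂)) (↭-trans (shift j s _) (prep j
            (↭-reflexive (sym (++-assoc s p p₂))))))))))
  lasso-K₄′ {a} {s} {b} {c} {p} {j} {m = m} l aj (there m∈) bm with ∈-∃++ m∈
  ... | p₃ , p₄ , refl =
    K₄-minor chord (Linked.head (linked-++⁻ʳ (a ∷ s) linked)) aj
      (linked-++⁻ˡ (a ∷ s) linked)
      (bm ∷ subst (Linked (Adj H)) (reverse-path j p₃ _)
        (linked-reverse (symm H) (j ∷ p₃ ∷ʳ _) (linked-++⁻ˡ (j ∷ p₃) (linked-++⁻ʳ (c ∷ p) rest))))
      (linked-++⁻ˡ (c ∷ p) rest)
      (proj₁ (unique-++⁻ _ (unique-resp-↭ σ unique)))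
    where
    open Lasso l
    rest = Linked.tail (linked-++⁻ʳ (a ∷ s) linked)
    σ : a ∷ s ++ b ∷ c ∷ p ++ j ∷ p₃ ++ m ∷ p₄ ↭
        ((a ∷ b ∷ c ∷ j ∷ []) ++ s ++ (m ∷ reverse p₃) ++ p) ++ p₄
    σ = prep a (↭-trans (shift b s _) (prep b (↭-trans (shift c s _) (prep c
          (↭-trans (++⁺ˡ s (shift j p _)) (↭-trans (shift j s _) (prep j
            (↭-trans (++⁺ˡ s ρ) (↭-reflexive (sym (++-assoc s _ p₄)))))))))))
      where
      ρ : p ++ p₃ ++ m ∷ p₄ ↭ ((m ∷ reverse p₃) ++ p) ++ p₄
      ρ = ↭-trans (++⁺ˡ p (shift m p₃ p₄)) (↭-trans (↭-reflexive (sym (++-assoc p (m ∷ p₃) p₄)))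
            (++⁺ʳ p₄ (↭-trans (++-comm p (m ∷ p₃)) (prep m (++⁺ʳ p (↭-sym (↭-reverse p₃)))))))

  -- If `m` precedes `j` on the tail, reversing the lasso exchanges the two tips, and `m` takes the
  -- role of `j`.
  lasso-K₄ : ∀ {a s b c post j m} → Lasso a s b c post →
             j ∈ post → Adj H a j → m ∈ post → Adj H b m → TopMinor (complete 4) H
  lasso-K₄ {a} {s} {b} {c} {post} {j} {m} l j∈ aj m∈ bm with ∈-∃++ j∈
  ... | p , p₂ , refl with ∈-++⁻ p m∈
  ...   | inj₂ m∈′ = lasso-K₄′ l aj m∈′ bm
  ...   | inj₁ m∈p with ∈-∃++ m∈p
  ...     | q₁ , q₂ , refl =
    lasso-K₄′ {p = q₁} (lasso-reverse (subst (Lasso a s b c) eq l)) bm (there (∈-++⁺ʳ q₂ (here refl))) aj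
    where
    eq : (q₁ ++ m ∷ q₂) ++ j ∷ p₂ ≡ q₁ ++ m ∷ q₂ ++ j ∷ p₂
    eq = ++-assoc q₁ (m ∷ q₂) (j ∷ p₂)

  -- The degree condition is imposed only on vertices with a neighbour: an isolated element of
  -- `Fin n` does not count as a vertex of `H`.
  module _ (deg≥3 : ∀ {x y} → Adj H x y → ∀ a b → ∃ λ c → Adj H x c × c ≢ a × c ≢ b) where

    open DecMembership (Fin._≟_ {n}) using (_∈?_)

    private
      absurd-length : ∀ {xs : List V} → n ℕ.< length xs → Unique xs → ⊥
      absurd-length lt u = ℕ.<⇒≱ lt (unique-length u)

      data Later (w : V) (ys : List V) : Set where
        later : ∀ s b post → ys ≡ s ++ b ∷ w ∷ post → Later w ys

      later-∈ : ∀ {w y ys} → w ∈ ys → Later w (y ∷ ys)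
      later-∈ {w} {y} w∈ with ∈-∃++ w∈
      ... | r₁ , r₂ , refl with initLast r₁
      ...   | []       = later [] y r₂ refl
      ...   | s ∷ʳ′ b = later (y ∷ s) b r₂ (cong (y ∷_) (shift-end s b (w ∷ r₂)))

      later⇒lasso : ∀ {a ys w s b post} → Linked (Adj H) (a ∷ ys) → Unique (a ∷ ys) →
                    Adj H a w → ys ≡ s ++ b ∷ w ∷ post → Lasso a s b w post
      later⇒lasso l u h refl = record { linked = l ; unique = u ; chord = h }

      path : V → List V → V → V → List V → List V
      path a s b c post = a ∷ s ++ b ∷ c ∷ post

      -- The path stays the same. The chord from `a` to `w` replaces the one to `c`, so the part of
      -- the cycle after `w` joins the tail.
      shorten : ∀ {a s b c post w} → Lasso a s b c post → Adj H a w →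
                ∀ {y ys} → s ∷ʳ b ≡ y ∷ ys → w ∈ ys →
                ∃ λ s′ → ∃₂ λ b′ post′ → Lasso a s′ b′ w post′ × length s′ ℕ.< length s ×
                  path a s b c post ≡ path a s′ b′ w post′
      shorten {a} {s} {b} {c} {post} {w} l aw {y} {ys} eq w∈ with later-∈ {y = y} w∈
      ... | later s′ b′ r eq′ =
        s′ , b′ , r ++ c ∷ post ,
        record { linked = subst (Linked (Adj H)) whole linked
               ; unique = subst Unique whole unique
               ; chord  = aw } ,
        lt , whole
        where
        open Lasso l
        whole : path a s b c post ≡ path a s′ b′ w (r ++ c ∷ post)
        whole = cong (a ∷_) (≡.trans (sym (shift-end s b (c ∷ post)))
          (≡.trans (cong (_++ c ∷ post) (≡.trans eq eq′)) (++-assoc s′ (b′ ∷ w ∷ r) (c ∷ post))))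
        len : suc (length s) ≡ length s′ + suc (suc (length r))
        len = ≡.trans (ℕ.+-comm 1 (length s)) (≡.trans (sym (length-++ s))
          (≡.trans (cong length (≡.trans eq eq′)) (length-++ s′)))
        lt : length s′ ℕ.< length s
        lt = ℕ.s≤s⁻¹ (ℕ.≤-trans (ℕ.≤-trans (ℕ.≤-reflexive (ℕ.+-comm 2 (length s′)))
               (ℕ.+-monoʳ-≤ (length s′) (s≤s (s≤s z≤n)))) (ℕ.≤-reflexive (sym len)))

      grow : ∀ k m → n ℕ.< suc k + m → n ℕ.< k + suc m
      grow k m = subst (n ℕ.<_) (sym (ℕ.+-suc k m))

    -- A further neighbour of a tip of the lasso lies off the path, which then becomes longer (at most
    -- k more times), or on the cycle, which then becomes shorter (at most m more times), or in post.
    -- If both tips have one in post, these give the subdivision.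

    mutual

      from-path : ∀ k {x y zs} → n ℕ.< k + length (x ∷ y ∷ zs) →
                  Linked (Adj H) (x ∷ y ∷ zs) → Unique (x ∷ y ∷ zs) → TopMinor (complete 4) H
      from-path k {x} {y} {zs} lt l u with deg≥3 (Linked.head l) y y
      ... | w , xw , w≢y , _ with w ∈? zs
      ...   | yes w∈ with later-∈ {y = y} w∈
      ...     | later s b post eq =
        from-lasso k _ (subst (λ ys → n ℕ.< k + length (x ∷ ys)) eq lt) ℕ.≤-refl
          (later⇒lasso l u xw eq)
      from-path k {x} {y} {zs} lt l u | w , xw , w≢y , _ | no w∉ =
        extend k lt l u xw λ { (here refl) → irrefl H refl xw ; (there (here eq)) → w≢y eq
                             ; (there (there p)) → w∉ p }

      extend : ∀ k {x xs w} → n ℕ.< k + length (x ∷ xs) → Linked (Adj H) (x ∷ xs) →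
               Unique (x ∷ xs) → Adj H x w → w ∉ x ∷ xs → TopMinor (complete 4) H
      extend zero    lt l u xw w∉ = ⊥-elim (absurd-length lt u)
      extend (suc k) lt l u xw w∉ = from-path k (grow k _ lt) (symm H xw ∷ l) (∉⇒All≢ w∉ ∷ u)

      from-lasso : ∀ k m {a s b c post} → n ℕ.< k + length (path a s b c post) → length s ≤ m →
                   Lasso a s b c post → TopMinor (complete 4) H
      from-lasso k m {a} {s} {b} {c} {post} lt le l with tip k m lt le l
      ... | inj₂ t = t
      ... | inj₁ (j , j∈ , aj) with tip k m lt′ le′ (lasso-reverse l)
        where
        lt′ = subst (n ℕ.<_) (cong (λ q → k + suc q) (≡.trans (length-++ s)
                (≡.trans (cong (_+ suc (suc (length post))) (sym (length-reverse s)))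
                  (sym (length-++ (reverse s)))))) lt
        le′ = subst (_≤ m) (sym (length-reverse s)) le
      ...   | inj₂ t = t
      ...   | inj₁ (j′ , j′∈ , bj′) = lasso-K₄ l j∈ aj j′∈ bj′

      tip : ∀ k m {a s b c post} → n ℕ.< k + length (path a s b c post) → length s ≤ m →
            Lasso a s b c post → (∃ λ j → j ∈ post × Adj H a j) ⊎ TopMinor (complete 4) H
      tip k m {a} {s} {b} {c} {post} lt le l = go (s ∷ʳ b) refl
        where
        open Lasso l
        go : ∀ ys → s ∷ʳ b ≡ ys → (∃ λ j → j ∈ post × Adj H a j) ⊎ TopMinor (complete 4) H
        go [] eq with () ← ≡.trans (sym (ℕ.+-comm (length s) 1)) (≡.trans (sym (length-++ s)) (cong length eq))
        go (y ∷ ys) eq with deg≥3 chord c y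
        -- `c` and `y` are the two neighbours of `a` on the cycle, so `w` is a third neighbour.
        ... | w , aw , w≢c , w≢y with w ∈? post | w ∈? ys
        ...   | yes w∈ | _      = inj₁ (w , w∈ , aw)
        ...   | no _   | yes w∈ = inj₂ (again m le (shorten l aw eq w∈))
          where
          again : ∀ m → length s ≤ m → _ → TopMinor (complete 4) H
          again zero    le (_ , _ , _ , _ , lt″ , _) = contradiction (ℕ.<-≤-trans lt″ le) λ ()
          again (suc m) le (_ , _ , _ , l′ , lt″ , eq′) =
            from-lasso k m (subst (λ p → n ℕ.< k + length p) eq′ lt) (ℕ.s≤s⁻¹ (ℕ.≤-trans lt″ le)) l′
        ...   | no w∉post | no w∉ys = inj₂ (extend k lt linked unique aw w∉)
          where
          w∉ : w ∉ path a s b c post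
          w∉ (here refl) = irrefl H refl aw
          w∉ (there p) with ∈-++⁻ (s ∷ʳ b) (subst (w ∈_) (sym (shift-end s b (c ∷ post))) p)
          ... | inj₁ q with subst (w ∈_) eq q
          ...   | here refl = w≢y refl
          ...   | there r   = w∉ys r
          w∉ (there p) | inj₂ (here refl) = w≢c refl
          w∉ (there p) | inj₂ (there q)   = w∉post q

    dirac : ∀ {x y} → Adj H x y → TopMinor (complete 4) H
    -- A budget of `n` extensions suffices, since a path without repetitions has at most `n`
    -- vertices.
    dirac {x} {y} h = from-path n (ℕ.m<m+n n {2} (s≤s z≤n)) (h ∷ [-])
      (((λ eq → irrefl H eq h) ∷ []) ∷ [] ∷ [])

-- Summaries of pieces and the finite checks on them

End : Set
End = Bool × Bool

code : End → Fin 4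
code (false , false) = 0F
code (false , true)  = 1F
code (true  , false) = 2F
code (true  , true)  = 3F

Kind : Set
Kind = Fin 11

-- A piece has two terminals y and z.  In value t (s , u) (s′ , u′), s says that y belongs to the
-- cover, u that y may be matched inside the piece, and s′ and u′ say the same of z.  The entry is
-- 3 plus the guaranteed surplus |M| − |C|, where C does not count the terminals; it is 0 if nothing is
-- guaranteed.  The eleven tables come from closing the table of an edge under the three
-- compositions below, keeping only minimal tables.

abstract

  table : Vec (Vec (Vec ℕ 4) 4) 11
  table =
    ((0 ∷ 0 ∷ 0 ∷ 0 ∷ []) ∷ (0 ∷ 0 ∷ 0 ∷ 0 ∷ []) ∷ (0 ∷ 0 ∷ 3 ∷ 4 ∷ []) ∷ (0 ∷ 0 ∷ 4 ∷ 5 ∷ []) ∷ []) ∷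
    ((0 ∷ 0 ∷ 0 ∷ 0 ∷ []) ∷ (0 ∷ 0 ∷ 0 ∷ 0 ∷ []) ∷ (3 ∷ 3 ∷ 3 ∷ 3 ∷ []) ∷ (4 ∷ 4 ∷ 4 ∷ 4 ∷ []) ∷ []) ∷
    ((0 ∷ 0 ∷ 3 ∷ 4 ∷ []) ∷ (0 ∷ 0 ∷ 3 ∷ 4 ∷ []) ∷ (0 ∷ 0 ∷ 3 ∷ 4 ∷ []) ∷ (0 ∷ 0 ∷ 3 ∷ 4 ∷ []) ∷ []) ∷
    ((1 ∷ 2 ∷ 3 ∷ 3 ∷ []) ∷ (2 ∷ 4 ∷ 4 ∷ 4 ∷ []) ∷ (3 ∷ 4 ∷ 4 ∷ 4 ∷ []) ∷ (3 ∷ 4 ∷ 4 ∷ 4 ∷ []) ∷ []) ∷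
    ((1 ∷ 3 ∷ 2 ∷ 3 ∷ []) ∷ (3 ∷ 4 ∷ 4 ∷ 4 ∷ []) ∷ (2 ∷ 4 ∷ 3 ∷ 4 ∷ []) ∷ (3 ∷ 4 ∷ 4 ∷ 4 ∷ []) ∷ []) ∷
    ((2 ∷ 2 ∷ 2 ∷ 2 ∷ []) ∷ (3 ∷ 4 ∷ 3 ∷ 4 ∷ []) ∷ (3 ∷ 3 ∷ 4 ∷ 4 ∷ []) ∷ (3 ∷ 4 ∷ 4 ∷ 4 ∷ []) ∷ []) ∷
    ((2 ∷ 3 ∷ 2 ∷ 3 ∷ []) ∷ (3 ∷ 3 ∷ 4 ∷ 4 ∷ []) ∷ (2 ∷ 4 ∷ 3 ∷ 4 ∷ []) ∷ (3 ∷ 4 ∷ 4 ∷ 4 ∷ []) ∷ []) ∷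
    ((2 ∷ 3 ∷ 3 ∷ 3 ∷ []) ∷ (2 ∷ 4 ∷ 3 ∷ 4 ∷ []) ∷ (2 ∷ 3 ∷ 4 ∷ 4 ∷ []) ∷ (2 ∷ 4 ∷ 4 ∷ 4 ∷ []) ∷ []) ∷
    ((3 ∷ 3 ∷ 3 ∷ 3 ∷ []) ∷ (3 ∷ 3 ∷ 3 ∷ 3 ∷ []) ∷ (3 ∷ 3 ∷ 3 ∷ 3 ∷ []) ∷ (3 ∷ 3 ∷ 3 ∷ 3 ∷ []) ∷ []) ∷
    ((0 ∷ 0 ∷ 2 ∷ 3 ∷ []) ∷ (0 ∷ 2 ∷ 4 ∷ 4 ∷ []) ∷ (2 ∷ 4 ∷ 3 ∷ 4 ∷ []) ∷ (3 ∷ 4 ∷ 4 ∷ 4 ∷ []) ∷ []) ∷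
    ((0 ∷ 0 ∷ 3 ∷ 3 ∷ []) ∷ (0 ∷ 4 ∷ 3 ∷ 4 ∷ []) ∷ (3 ∷ 3 ∷ 3 ∷ 3 ∷ []) ∷ (3 ∷ 4 ∷ 3 ∷ 4 ∷ []) ∷ []) ∷ []

  value : Kind → End → End → ℕ
  value t e f = Vec.lookup (Vec.lookup (Vec.lookup table t) (code e)) (code f)

-- Two parallel copies of an edge guarantee too little, so there is no parallel composition of two Direct
-- kinds.  As the graph is simple, two parallel pieces are never both Direct.

Direct : Kind → Set
Direct t = 9 ≤ toℕ t

direct? : ∀ t → Dec (Direct t)
direct? t = 9 ℕ.≤? toℕ t

edgeKind : Kind
edgeKind = fromℕ 10

cost : Bool → ℕ
cost b = if b then 1 else 0

-- In terms of the surpluses, which are the entries minus 3: the two surpluses, less `c` newly paid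
-- cover vertices, must reach the surplus of the result. The offset occurs twice on the right and
-- once on the left, hence `3 + c`. An entry 0 promises nothing and cannot be an ingredient.
Fits : ℕ → ℕ → ℕ → ℕ → Set
Fits c w₁ w₂ w = w ≡ 0 ⊎ (0 ℕ.< w₁ × 0 ℕ.< w₂ × w + (3 + c) ≤ w₁ + w₂)

fits? : ∀ c w₁ w₂ w → Dec (Fits c w₁ w₂ w)
fits? c w₁ w₂ w = w ℕ.≟ 0 ⊎-dec (0 ℕ.<? w₁ ×-dec 0 ℕ.<? w₂ ×-dec w + (3 + c) ℕ.≤? w₁ + w₂)

all-Bool? : {P : Bool → Set} → (∀ b → Dec (P b)) → Dec (∀ b → P b)
all-Bool? P? = map′ (λ { (f , t) false → f ; (f , t) true → t }) (λ h → h false , h true)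
                    (P? false ×-dec P? true)

any-Bool? : {P : Bool → Set} → (∀ b → Dec (P b)) → Dec (∃ P)
any-Bool? P? = map′ (λ { (inj₁ p) → false , p ; (inj₂ p) → true , p })
                    (λ { (false , p) → inj₁ p ; (true , p) → inj₂ p })
                    (P? false ⊎-dec P? true)

all-End? : {P : End → Set} → (∀ e → Dec (P e)) → Dec (∀ e → P e)
all-End? P? = map′ (λ h (s , u) → h s u) (λ h s u → h (s , u)) (all-Bool? λ s → all-Bool? λ u → P? (s , u))

Flipped : Kind → Kind → Set
Flipped t t′ = (Direct t′ → Direct t) × (∀ e f → value t′ e f ≡ value t f e)

-- Both pieces are read from their common terminal, which becomes interior. `s` decides whether it
-- enters the cover, which now has to be paid for, and `k` which piece may match it.
Series : Kind → Kind → Kind → Set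
Series t₁ t₂ t = ¬ Direct t × ∀ e f → ∃₂ λ s k →
  Fits (cost s) (value t₁ (s , k) e) (value t₂ (s , not k) f) (value t e f)

-- Both terminals remain terminals, so nothing is paid. The permission to match a terminal is passed
-- to one side only, chosen by `k` and `k′`.
Parallel : Kind → Kind → Kind → Set
Parallel t₁ t₂ t = (Direct t → Direct t₁ ⊎ Direct t₂) × ∀ s u s′ u′ → ∃₂ λ k k′ →
  Fits 0 (value t₁ (s , u ∧ k) (s′ , u′ ∧ k′)) (value t₂ (s , u ∧ not k) (s′ , u′ ∧ not k′))
       (value t (s , u) (s′ , u′))

-- The far end of the first piece becomes interior and meets nothing else, so it may be matched
-- freely. The near end is the first terminal of the second piece and stays a terminal.
Pendant : Kind → Kind → Kind → Set
Pendant t₁ t₂ t = (Direct t → Direct t₂) × ∀ s u f → ∃₂ λ s′ k →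
  Fits (cost s′) (value t₁ (s′ , true) (s , u ∧ k)) (value t₂ (s , u ∧ not k) f) (value t (s , u) f)

-- A piece that forms a whole component must keep a nonnegative surplus after paying for its
-- terminals in the cover.
Closed : Kind → Set
Closed t = ∃₂ λ s s′ → 3 + (cost s + cost s′) ≤ value t (s , true) (s′ , true)

abstract

  flipped : ∀ t → ∃ (Flipped t)
  flipped = from-yes (Fin.all? λ t → Fin.any? λ t′ → (direct? t′ →-dec direct? t) ×-dec
    all-End? λ e → all-End? λ f → value t′ e f ℕ.≟ value t f e)

  series : ∀ t₁ t₂ → ∃ (Series t₁ t₂)
  series = from-yes (Fin.all? λ t₁ → Fin.all? λ t₂ → Fin.any? λ t → ¬? (direct? t) ×-dec
    all-End? λ e → all-End? λ f → any-Bool? λ s → any-Bool? λ k →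
    fits? (cost s) (value t₁ (s , k) e) (value t₂ (s , not k) f) (value t e f))

  parallel : ∀ t₁ t₂ → ¬ (Direct t₁ × Direct t₂) → ∃ (Parallel t₁ t₂)
  parallel = from-yes (Fin.all? λ t₁ → Fin.all? λ t₂ → ¬? (direct? t₁ ×-dec direct? t₂) →-dec
    Fin.any? λ t → (direct? t →-dec (direct? t₁ ⊎-dec direct? t₂)) ×-dec
    all-Bool? λ s → all-Bool? λ u → all-Bool? λ s′ → all-Bool? λ u′ → any-Bool? λ k → any-Bool? λ k′ →
    fits? 0 (value t₁ (s , u ∧ k) (s′ , u′ ∧ k′)) (value t₂ (s , u ∧ not k) (s′ , u′ ∧ not k′))
          (value t (s , u) (s′ , u′)))

  pendant : ∀ t₁ t₂ → ∃ (Pendant t₁ t₂)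
  pendant = from-yes (Fin.all? λ t₁ → Fin.all? λ t₂ → Fin.any? λ t → (direct? t →-dec direct? t₂) ×-dec
    all-Bool? λ s → all-Bool? λ u → all-End? λ f → any-Bool? λ s′ → any-Bool? λ k →
    fits? (cost s′) (value t₁ (s′ , true) (s , u ∧ k)) (value t₂ (s , u ∧ not k) f) (value t (s , u) f))

  closed : ∀ t → Closed t
  closed = from-yes (Fin.all? λ t → any-Bool? λ s → any-Bool? λ s′ →
    3 + (cost s + cost s′) ℕ.≤? value t (s , true) (s′ , true))

  -- Surplus 1 if the edge can be matched, surplus 0 if a terminal covers it, and otherwise no
  -- guarantee.
  edge-value : ∀ s u s′ u′ → value edgeKind (s , u) (s′ , u′) ≡
               (if u ∧ u′ then 4 else if s ∨ s′ then 3 else 0)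
  edge-value = from-yes (all-Bool? λ s → all-Bool? λ u → all-Bool? λ s′ → all-Bool? λ u′ →
    value edgeKind (s , u) (s′ , u′) ℕ.≟ (if u ∧ u′ then 4 else if s ∨ s′ then 3 else 0))

-- Two-terminal pieces

ends : ∀ {n} → List (Pair n) → List (Fin n)
ends []            = []
ends ((p , q) ∷ M) = p ∷ q ∷ ends M

ends-++ : ∀ {n} (M N : List (Pair n)) → ends (M ++ N) ≡ ends M ++ ends N
ends-++ []            N = refl
ends-++ ((p , q) ∷ M) N = cong (λ xs → p ∷ q ∷ xs) (ends-++ M N)

Covered : ∀ {n} → List (Pair n) → List (Fin n) → Pair n → Set
Covered M S (p , q) = (p , q) ∈ M ⊎ p ∈ S ⊎ q ∈ S

covered-mono : ∀ {n} {M N : List (Pair n)} {S T} → M ⊆ N → S ⊆ T → ∀ {e} → Covered M S e → Covered N T e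
covered-mono f g (inj₁ m)        = inj₁ (f m)
covered-mono f g (inj₂ (inj₁ m)) = inj₂ (inj₁ (g m))
covered-mono f g (inj₂ (inj₂ m)) = inj₂ (inj₂ (g m))

pick : ∀ {A : Set} → Bool → A → List A
pick b x = if b then [ x ] else []

pick-∈ : ∀ {A : Set} b {x y : A} → y ∈ pick b x → y ≡ x × b ≡ true
pick-∈ true (here refl) = refl , refl

pick-length : ∀ {A : Set} b {x : A} → length (pick b x) ≡ cost b
pick-length false = refl
pick-length true  = refl

module _ {n} (G : Graph n) where

  private
    V = Fin n

  -- `E` is to be covered, `A` holds the vertices available to the matching, and `S` the cover
  -- vertices paid for elsewhere. The number `w` is 3 plus the guaranteed surplus.
  record Solution (E : List (Pair n)) (A S : List V) (w : ℕ) : Set where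
    field
      M        : List (Pair n)
      C        : List V
      edges    : ∀ {p q} → (p , q) ∈ M → Adj G p q
      matching : Unique (ends M)
      ends⊆    : ends M ⊆ A
      covers   : ∀ {e} → e ∈ E → Covered M (C ++ S) e
      bound    : length C + w ≤ length M + 3

  -- `D` consists of the cover vertices that the parts took as given and that the union must pay for
  -- itself. The union of the matchings is a matching because the available vertices are disjoint.
  join : ∀ {E₁ E₂ A₁ A₂ S₁ S₂ A S w₁ w₂ w} D →
         Solution E₁ A₁ S₁ w₁ → Solution E₂ A₂ S₂ w₂ → Disjoint A₁ A₂ → A₁ ⊆ A → A₂ ⊆ A →
         S₁ ⊆ D ++ S → S₂ ⊆ D ++ S → w + (3 + length D) ≤ w₁ + w₂ → Solution (E₁ ++ E₂) A S w
  join {E₁} {A₁ = A₁} {S₁ = S₁} {S₂} {A} {S} {w₁} {w₂} {w} D s₁ s₂ dis A₁⊆ A₂⊆ S₁⊆ S₂⊆ le = record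
    { M        = s₁.M ++ s₂.M
    ; C        = D ++ s₁.C ++ s₂.C
    ; edges    = λ m → [ s₁.edges , s₂.edges ]′ (∈-++⁻ s₁.M m)
    ; matching = subst Unique (sym (ends-++ s₁.M s₂.M))
        (Unique.++⁺ s₁.matching s₂.matching λ (m , k) → dis (s₁.ends⊆ m , s₂.ends⊆ k))
    ; ends⊆    = λ m → [ A₁⊆ ∘ s₁.ends⊆ , A₂⊆ ∘ s₂.ends⊆ ]′
        (∈-++⁻ (ends s₁.M) (subst (_ ∈_) (ends-++ s₁.M s₂.M) m))
    ; covers   = λ m → [ covered-mono ∈-++⁺ˡ (widen s₁.C S₁⊆ (∈-++⁺ʳ D ∘ ∈-++⁺ˡ)) ∘ s₁.covers
                       , covered-mono (∈-++⁺ʳ s₁.M) (widen s₂.C S₂⊆ (∈-++⁺ʳ D ∘ ∈-++⁺ʳ s₁.C)) ∘ s₂.covers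
                       ]′ (∈-++⁻ E₁ m)
    ; bound    = bound
    }
    where
    module s₁ = Solution s₁
    module s₂ = Solution s₂
    C = D ++ s₁.C ++ s₂.C
    widen : ∀ C′ {S′} → S′ ⊆ D ++ S → C′ ⊆ C → C′ ++ S′ ⊆ C ++ S
    widen C′ S′⊆ C′⊆ m with ∈-++⁻ C′ m
    ... | inj₁ k = ∈-++⁺ˡ (C′⊆ k)
    ... | inj₂ k with ∈-++⁻ D (S′⊆ k)
    ...   | inj₁ d = ∈-++⁺ˡ (∈-++⁺ˡ d)
    ...   | inj₂ r = ∈-++⁺ʳ C r
    rearrange₁ : ∀ d c₁ c₂ w → d + (c₁ + c₂) + w + 3 ≡ c₁ + c₂ + (w + (3 + d))
    rearrange₁ = solve-∀
    rearrange₂ : ∀ c₁ c₂ w₁ w₂ → c₁ + c₂ + (w₁ + w₂) ≡ (c₁ + w₁) + (c₂ + w₂)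
    rearrange₂ = solve-∀
    rearrange₃ : ∀ m₁ m₂ → (m₁ + 3) + (m₂ + 3) ≡ m₁ + m₂ + 3 + 3
    rearrange₃ = solve-∀
    bound : length C + w ≤ length (s₁.M ++ s₂.M) + 3
    -- The sum of the two bounds carries the offset twice, so 3 is added on both sides and
    -- cancelled.
    bound = ℕ.+-cancelʳ-≤ 3 _ _ (begin
      length C + w + 3
        ≡⟨ cong (λ l → l + w + 3) (≡.trans (length-++ D) (cong (length D +_) (length-++ s₁.C))) ⟩
      length D + (length s₁.C + length s₂.C) + w + 3
        ≡⟨ rearrange₁ (length D) (length s₁.C) (length s₂.C) w ⟩
      length s₁.C + length s₂.C + (w + (3 + length D))
        ≤⟨ ℕ.+-monoʳ-≤ (length s₁.C + length s₂.C) le ⟩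
      length s₁.C + length s₂.C + (w₁ + w₂)
        ≡⟨ rearrange₂ (length s₁.C) (length s₂.C) w₁ w₂ ⟩
      (length s₁.C + w₁) + (length s₂.C + w₂)
        ≤⟨ ℕ.+-mono-≤ s₁.bound s₂.bound ⟩
      (length s₁.M + 3) + (length s₂.M + 3)
        ≡⟨ rearrange₃ (length s₁.M) (length s₂.M) ⟩
      length s₁.M + length s₂.M + 3 + 3
        ≡⟨ cong (λ l → l + 3 + 3) (sym (length-++ s₁.M)) ⟩
      length (s₁.M ++ s₂.M) + 3 + 3 ∎)
      where open ℕ.≤-Reasoning

  -- The path `inner` later replaces an edge of the graph formed by the pieces. `solution` is
  -- required only at positive entries, 0 standing for no promise.
  record Piece (y z : V) (X : List V) (E : List (Pair n)) : Set where
    field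
      kind         : Kind
      solution     : ∀ s u s′ u′ → 0 ℕ.< value kind (s , u) (s′ , u′) →
                     Solution E (pick u y ++ pick u′ z ++ X) (pick s y ++ pick s′ z)
                       (value kind (s , u) (s′ , u′))
      inner        : List V
      inner⊆       : inner ⊆ X
      inner-unique : Unique inner
      inner-linked : Linked (Adj G) (y ∷ inner ∷ʳ z)

  open Piece

  private
    variable
      x y z : V
      X X₁ X₂ : List V
      E E₁ E₂ : List (Pair n)

    data From (a : Bool) (y : V) (b : Bool) (z : V) (X : List V) (v : V) : Set where
      first  : v ≡ y → a ≡ true → From a y b z X v
      second : v ≡ z → b ≡ true → From a y b z X v
      third  : v ∈ X → From a y b z X v

    from : ∀ a {y} b {z X v} → v ∈ pick a y ++ pick b z ++ X → From a y b z X v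
    from a b m with ∈-++⁻ (pick a _) m
    ... | inj₁ k = Product.uncurry first (pick-∈ a k)
    ... | inj₂ k with ∈-++⁻ (pick b _) k
    ...   | inj₁ l = Product.uncurry second (pick-∈ b l)
    ...   | inj₂ l = third l

    to : ∀ a {y} b {z X v} → From a y b z X v → v ∈ pick a y ++ pick b z ++ X
    to true  b (first refl refl)  = here refl
    to a true  (second refl refl) = ∈-++⁺ʳ (pick a _) (here refl)
    to a b (third m)              = ∈-++⁺ʳ (pick a _) (∈-++⁺ʳ (pick b _) m)

    not-both : ∀ k → k ≡ true → not k ≡ true → ⊥
    not-both true  _  ()
    not-both false () _

    split : ∀ u k → u ∧ k ≡ true → u ∧ not k ≡ true → ⊥
    split true = not-both

    ∧-left : ∀ u {k} → u ∧ k ≡ true → u ≡ true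
    ∧-left true _ = refl

  edgePiece : Adj G y z → y ≢ z → Piece y z [] [ (y , z) ]
  edgePiece {y} {z} yz y≢z = record
    { kind         = edgeKind
    ; solution     = λ s u s′ u′ → subst (λ w → 0 ℕ.< w → Solution _ _ _ w)
        (sym (edge-value s u s′ u′)) (pair s u s′ u′)
    ; inner        = []
    ; inner⊆       = id
    ; inner-unique = []
    ; inner-linked = yz ∷ [-]
    }
    where
    take : ∀ S → Solution [ (y , z) ] (y ∷ z ∷ []) S 4
    take S = record
      { M        = [ (y , z) ]
      ; C        = []
      ; edges    = λ { (here refl) → yz }
      ; matching = (y≢z ∷ []) ∷ [] ∷ []
      ; ends⊆    = id
      ; covers   = inj₁
      ; bound    = ℕ.≤-refl
      }
    skip : ∀ A S → y ∈ S ⊎ z ∈ S → Solution [ (y , z) ] A S 3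
    skip A S c = record
      { M        = []
      ; C        = []
      ; edges    = λ ()
      ; matching = []
      ; ends⊆    = λ ()
      ; covers   = λ { (here refl) → inj₂ c }
      ; bound    = ℕ.≤-refl
      }
    pair : ∀ s u s′ u′ → 0 ℕ.< (if u ∧ u′ then 4 else if s ∨ s′ then 3 else 0) →
           Solution [ (y , z) ] (pick u y ++ pick u′ z ++ []) (pick s y ++ pick s′ z)
             (if u ∧ u′ then 4 else if s ∨ s′ then 3 else 0)
    pair s     true  s′   true  _ = take _
    pair true  true  s′   false _ = skip _ _ (inj₁ (here refl))
    pair true  false s′   u′    _ = skip _ _ (inj₁ (here refl))
    pair false true  true false _ = skip _ _ (inj₂ (here refl))
    pair false false true u′    _ = skip _ _ (inj₂ (here refl))

  flipPiece : (p : Piece y z X E) → ∃ λ (q : Piece z y X E) → Direct (kind q) → Direct (kind p)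
  flipPiece {y} {z} {X} {E} p with flipped (kind p)
  ... | t , direct , eq = q , direct
    where
    turn : ∀ s u s′ u′ {w} → Solution E (pick u y ++ pick u′ z ++ X) (pick s y ++ pick s′ z) w →
           Solution E (pick u′ z ++ pick u y ++ X) (pick s′ z ++ pick s y) w
    turn s u s′ u′ sol = record
      { M        = M
      ; C        = C
      ; edges    = edges
      ; matching = matching
      ; ends⊆    = ∈-resp-↭ (↭-trans (↭-reflexive (sym (++-assoc (pick u y) (pick u′ z) X)))
                     (↭-trans (++⁺ʳ X (++-comm (pick u y) (pick u′ z)))
                       (↭-reflexive (++-assoc (pick u′ z) (pick u y) X)))) ∘ ends⊆
      ; covers   = covered-mono id (∈-resp-↭ (++⁺ˡ C (++-comm (pick s y) (pick s′ z)))) ∘ covers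
      ; bound    = bound
      }
      where open Solution sol
    q : Piece z y X E
    q = record
      { kind         = t
      ; solution     = λ s u s′ u′ pos → subst (Solution E _ _) (sym (eq (s , u) (s′ , u′)))
          (turn s′ u′ s u (solution p s′ u′ s u (subst (0 ℕ.<_) (eq (s , u) (s′ , u′)) pos)))
      ; inner        = reverse (inner p)
      ; inner⊆       = inner⊆ p ∘ ∈-resp-↭ (↭-reverse (inner p))
      ; inner-unique = unique-resp-↭ (↭-sym (↭-reverse (inner p))) (inner-unique p)
      ; inner-linked = subst (Linked (Adj G)) (reverse-path y (inner p) z)
          (linked-reverse (symm G) (y ∷ inner p ∷ʳ z) (inner-linked p))
      }

  seriesPiece : (p : Piece x y X₁ E₁) (q : Piece x z X₂ E₂) → x ≢ y → x ≢ z → y ≢ z →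
                Disjoint (x ∷ y ∷ z ∷ []) X₁ → Disjoint (x ∷ y ∷ z ∷ []) X₂ → Disjoint X₁ X₂ →
                ∃ λ (r : Piece y z (x ∷ X₁ ++ X₂) (E₁ ++ E₂)) → ¬ Direct (kind r)
  seriesPiece {x} {y} {X₁} {E₁} {z} {X₂} {E₂} p q x≢y x≢z y≢z out₁ out₂ dis
    with series (kind p) (kind q)
  ... | t , direct , fit = r , direct
    where
    Z = x ∷ X₁ ++ X₂
    sol : ∀ s u s′ u′ → 0 ℕ.< value t (s , u) (s′ , u′) →
          Solution (E₁ ++ E₂) (pick u y ++ pick u′ z ++ Z) (pick s y ++ pick s′ z)
            (value t (s , u) (s′ , u′))
    sol s u s′ u′ pos with fit (s , u) (s′ , u′)
    ... | _ , _ , inj₁ eq = contradiction eq (ℕ.>⇒≢ pos)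
    ... | sx , k , inj₂ (pos₁ , pos₂ , le) =
      join (pick sx x) (solution p sx k s u pos₁) (solution q sx (not k) s′ u′ pos₂)
        (λ (m , l) → apart (from k u m) (from (not k) u′ l))
        (in₁ ∘ from k u) (in₂ ∘ from (not k) u′)
        (λ m → [ ∈-++⁺ˡ , ∈-++⁺ʳ (pick sx x) ∘ ∈-++⁺ˡ ]′ (∈-++⁻ (pick sx x) m))
        (λ m → [ ∈-++⁺ˡ , ∈-++⁺ʳ (pick sx x) ∘ ∈-++⁺ʳ (pick s y) ]′ (∈-++⁻ (pick sx x) m))
        (subst (λ c → _ + (3 + c) ≤ _) (sym (pick-length sx)) le)
      where
      apart : ∀ {v} → From k x u y X₁ v → From (not k) x u′ z X₂ v → ⊥
      apart (first refl eq)  (first _ eq′)    = not-both k eq eq′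
      apart (first refl _)   (second eq _)    = x≢z eq
      apart (first refl _)   (third m)        = out₂ (here refl , m)
      apart (second refl _)  (first eq _)     = x≢y (sym eq)
      apart (second refl _)  (second eq _)    = y≢z eq
      apart (second refl _)  (third m)        = out₂ (there (here refl) , m)
      apart (third m)        (first refl _)   = out₁ (here refl , m)
      apart (third m)        (second refl _)  = out₁ (there (there (here refl)) , m)
      apart (third m)        (third l)        = dis (m , l)
      in₁ : ∀ {v} → From k x u y X₁ v → v ∈ pick u y ++ pick u′ z ++ Z
      in₁ (first refl _)   = to u u′ (third (here refl))
      in₁ (second refl eq) = to u u′ (first refl eq)
      in₁ (third m)        = to u u′ (third (there (∈-++⁺ˡ m)))
      in₂ : ∀ {v} → From (not k) x u′ z X₂ v → v ∈ pick u y ++ pick u′ z ++ Z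
      in₂ (first refl _)   = to u u′ (third (here refl))
      in₂ (second refl eq) = to u u′ (second refl eq)
      in₂ (third m)        = to u u′ (third (there (∈-++⁺ʳ X₁ m)))
    r : Piece y z Z (E₁ ++ E₂)
    r = record
      { kind         = t
      ; solution     = sol
      ; inner        = reverse (inner p) ++ x ∷ inner q
      ; inner⊆       = λ m → [ there ∘ ∈-++⁺ˡ ∘ inner⊆ p ∘ ∈-resp-↭ (↭-reverse (inner p))
                             , (λ { (here eq) → here eq ; (there l) → there (∈-++⁺ʳ X₁ (inner⊆ q l)) })
                             ]′ (∈-++⁻ (reverse (inner p)) m)
      ; inner-unique = Unique.++⁺ (unique-resp-↭ (↭-sym (↭-reverse (inner p))) (inner-unique p))
          (∉⇒All≢ (λ m → out₂ (here refl , inner⊆ q m)) ∷ inner-unique q)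
          λ { (m , here refl) → out₁ (here refl , inner⊆ p (∈-resp-↭ (↭-reverse (inner p)) m))
            ; (m , there l)   → dis (inner⊆ p (∈-resp-↭ (↭-reverse (inner p)) m) , inner⊆ q l) }
      ; inner-linked = subst (Linked (Adj G))
          (cong (y ∷_) (sym (++-assoc (reverse (inner p)) (x ∷ inner q) [ z ])))
          (linked-++ (y ∷ reverse (inner p))
            (subst (Linked (Adj G)) (reverse-path x (inner p) y)
              (linked-reverse (symm G) (x ∷ inner p ∷ʳ y) (inner-linked p)))
            (inner-linked q))
      }

  parallelPiece : (p : Piece y z X₁ E₁) (q : Piece y z X₂ E₂) → y ≢ z →
                  Disjoint (y ∷ z ∷ []) X₁ → Disjoint (y ∷ z ∷ []) X₂ → Disjoint X₁ X₂ →
                  ¬ (Direct (kind p) × Direct (kind q)) →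
                  ∃ λ (r : Piece y z (X₁ ++ X₂) (E₁ ++ E₂)) →
                    Direct (kind r) → Direct (kind p) ⊎ Direct (kind q)
  parallelPiece {y} {z} {X₁} {E₁} {X₂} {E₂} p q y≢z out₁ out₂ dis ¬both
    with parallel (kind p) (kind q) ¬both
  ... | t , direct , fit = r , direct
    where
    Z = X₁ ++ X₂
    sol : ∀ s u s′ u′ → 0 ℕ.< value t (s , u) (s′ , u′) →
          Solution (E₁ ++ E₂) (pick u y ++ pick u′ z ++ Z) (pick s y ++ pick s′ z)
            (value t (s , u) (s′ , u′))
    sol s u s′ u′ pos with fit s u s′ u′
    ... | _ , _ , inj₁ eq = contradiction eq (ℕ.>⇒≢ pos)
    ... | k , k′ , inj₂ (pos₁ , pos₂ , le) =
      join [] (solution p s (u ∧ k) s′ (u′ ∧ k′) pos₁) (solution q s (u ∧ not k) s′ (u′ ∧ not k′) pos₂)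
        (λ (m , l) → apart (from (u ∧ k) (u′ ∧ k′) m) (from (u ∧ not k) (u′ ∧ not k′) l))
        (inside k k′ ∈-++⁺ˡ ∘ from (u ∧ k) (u′ ∧ k′))
        (inside (not k) (not k′) (∈-++⁺ʳ X₁) ∘ from (u ∧ not k) (u′ ∧ not k′))
        id id le
      where
      apart : ∀ {v} → From (u ∧ k) y (u′ ∧ k′) z X₁ v → From (u ∧ not k) y (u′ ∧ not k′) z X₂ v → ⊥
      apart (first refl eq)  (first _ eq′)    = split u k eq eq′
      apart (first refl _)   (second eq _)    = y≢z eq
      apart (first refl _)   (third m)        = out₂ (here refl , m)
      apart (second refl _)  (first eq _)     = y≢z (sym eq)
      apart (second refl eq) (second _ eq′)   = split u′ k′ eq eq′
      apart (second refl _)  (third m)        = out₂ (there (here refl) , m)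
      apart (third m)        (first refl _)   = out₁ (here refl , m)
      apart (third m)        (second refl _)  = out₁ (there (here refl) , m)
      apart (third m)        (third l)        = dis (m , l)
      inside : ∀ k k′ {X′} → X′ ⊆ Z → ∀ {v} → From (u ∧ k) y (u′ ∧ k′) z X′ v → v ∈ pick u y ++ pick u′ z ++ Z
      inside k k′ X′⊆ (first refl eq)  = to u u′ (first refl (∧-left u eq))
      inside k k′ X′⊆ (second refl eq) = to u u′ (second refl (∧-left u′ eq))
      inside k k′ X′⊆ (third m)        = to u u′ (third (X′⊆ m))
    r : Piece y z Z (E₁ ++ E₂)
    r = record
      { kind         = t
      ; solution     = sol
      ; inner        = inner p
      ; inner⊆       = ∈-++⁺ˡ ∘ inner⊆ p
      ; inner-unique = inner-unique p
      ; inner-linked = inner-linked p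
      }

  pendantPiece : (p : Piece x y X₁ E₁) (q : Piece y z X₂ E₂) → x ≢ y → x ≢ z → y ≢ z →
                 Disjoint (x ∷ y ∷ z ∷ []) X₁ → Disjoint (x ∷ y ∷ z ∷ []) X₂ → Disjoint X₁ X₂ →
                 ∃ λ (r : Piece y z (x ∷ X₁ ++ X₂) (E₁ ++ E₂)) → Direct (kind r) → Direct (kind q)
  pendantPiece {x} {y} {X₁} {E₁} {z} {X₂} {E₂} p q x≢y x≢z y≢z out₁ out₂ dis
    with pendant (kind p) (kind q)
  ... | t , direct , fit = r , direct
    where
    Z = x ∷ X₁ ++ X₂
    sol : ∀ s u s′ u′ → 0 ℕ.< value t (s , u) (s′ , u′) →
          Solution (E₁ ++ E₂) (pick u y ++ pick u′ z ++ Z) (pick s y ++ pick s′ z)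
            (value t (s , u) (s′ , u′))
    sol s u s′ u′ pos with fit s u (s′ , u′)
    ... | _ , _ , inj₁ eq = contradiction eq (ℕ.>⇒≢ pos)
    ... | sx , k , inj₂ (pos₁ , pos₂ , le) =
      join (pick sx x) (solution p sx true s (u ∧ k) pos₁) (solution q s (u ∧ not k) s′ u′ pos₂)
        (λ (m , l) → apart (from true (u ∧ k) m) (from (u ∧ not k) u′ l))
        (in₁ ∘ from true (u ∧ k)) (in₂ ∘ from (u ∧ not k) u′)
        (λ m → [ ∈-++⁺ˡ , ∈-++⁺ʳ (pick sx x) ∘ ∈-++⁺ˡ ]′ (∈-++⁻ (pick sx x) m))
        (∈-++⁺ʳ (pick sx x))
        (subst (λ c → _ + (3 + c) ≤ _) (sym (pick-length sx)) le)
      where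
      apart : ∀ {v} → From true x (u ∧ k) y X₁ v → From (u ∧ not k) y u′ z X₂ v → ⊥
      apart (first refl _)   (first eq _)     = x≢y eq
      apart (first refl _)   (second eq _)    = x≢z eq
      apart (first refl _)   (third m)        = out₂ (here refl , m)
      apart (second refl eq) (first _ eq′)    = split u k eq eq′
      apart (second refl _)  (second eq _)    = y≢z eq
      apart (second refl _)  (third m)        = out₂ (there (here refl) , m)
      apart (third m)        (first refl _)   = out₁ (there (here refl) , m)
      apart (third m)        (second refl _)  = out₁ (there (there (here refl)) , m)
      apart (third m)        (third l)        = dis (m , l)
      in₁ : ∀ {v} → From true x (u ∧ k) y X₁ v → v ∈ pick u y ++ pick u′ z ++ Z
      in₁ (first refl _)   = to u u′ (third (here refl))
      in₁ (second refl eq) = to u u′ (first refl (∧-left u eq))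
      in₁ (third m)        = to u u′ (third (there (∈-++⁺ˡ m)))
      in₂ : ∀ {v} → From (u ∧ not k) y u′ z X₂ v → v ∈ pick u y ++ pick u′ z ++ Z
      in₂ (first refl eq)  = to u u′ (first refl (∧-left u eq))
      in₂ (second refl eq) = to u u′ (second refl eq)
      in₂ (third m)        = to u u′ (third (there (∈-++⁺ʳ X₁ m)))
    r : Piece y z Z (E₁ ++ E₂)
    r = record
      { kind         = t
      ; solution     = sol
      ; inner        = inner q
      ; inner⊆       = there ∘ ∈-++⁺ʳ X₁ ∘ inner⊆ q
      ; inner-unique = inner-unique q
      ; inner-linked = inner-linked q
      }

  closePiece : Piece y z X E → Solution E (y ∷ z ∷ X) [] 3
  closePiece {y} {z} {X} {E} p with closed (kind p)
  ... | s , s′ , le = record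
    { M        = M
    ; C        = C ++ pick s y ++ pick s′ z
    ; edges    = edges
    ; matching = matching
    ; ends⊆    = ends⊆
    ; covers   = covered-mono id ∈-++⁺ˡ ∘ covers
    ; bound    = ℕ.≤-trans (ℕ.≤-reflexive eq) (ℕ.≤-trans (ℕ.+-monoʳ-≤ (length C) le) bound)
    }
    where
    open Solution (solution p s true s′ true (ℕ.≤-trans (s≤s z≤n) le))
    eq : length (C ++ pick s y ++ pick s′ z) + 3 ≡ length C + (3 + (cost s + cost s′))
    eq = ≡.trans (cong (_+ 3) (≡.trans (length-++ C) (cong (length C +_)
           (≡.trans (length-++ (pick s y)) (≡.cong₂ _+_ (pick-length s) (pick-length s′))))))
         (rearrange (length C) (cost s + cost s′))
      where
      rearrange : ∀ c d → c + d + 3 ≡ c + (3 + d)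
      rearrange = solve-∀

-- Networks of pieces

module _ {A : Set} where

  extract : ∀ {x : A} {xs} → x ∈ xs → ∃ λ ys → xs ↭ x ∷ ys
  extract x∈ with ∈-∃++ x∈
  ... | as , bs , refl = as ++ bs , shift _ as bs

  findPair : {R : Rel A 0ℓ} → Binary.Decidable R → ∀ xs →
             AllPairs (λ x y → ¬ R x y) xs ⊎ ∃₂ λ x y → R x y × ∃ λ zs → xs ↭ x ∷ y ∷ zs
  findPair R? []       = inj₁ []
  findPair R? (x ∷ xs) with Any.any? (R? x) xs
  ... | yes any with find any
  ...   | y , y∈ , r = inj₂ (x , y , r , Product.map₂ (prep x) (extract y∈))
  findPair R? (x ∷ xs) | no ¬any with findPair R? xs
  ...   | inj₁ ps = inj₁ (¬Any⇒All¬ xs ¬any ∷ ps)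
  ...   | inj₂ (y , z , r , zs , σ) =
    inj₂ (y , z , r , x ∷ zs , ↭-trans (prep x σ) (↭-trans (swap x y refl) (prep y (swap x z refl))))

  allPairs-lookup : {R : Rel A 0ℓ} → ∀ {x y xs} → AllPairs R xs → x ∈ xs → y ∈ xs →
                    x ≡ y ⊎ R x y ⊎ R y x
  allPairs-lookup (_ ∷ _)  (here refl) (here refl) = inj₁ refl
  allPairs-lookup (r ∷ _)  (here refl) (there q)   = inj₂ (inj₁ (All.lookup r q))
  allPairs-lookup (r ∷ _)  (there p)   (here refl) = inj₂ (inj₂ (All.lookup r p))
  allPairs-lookup (_ ∷ rs) (there p)   (there q)   = allPairs-lookup rs p q

concatMap-↭ : ∀ {A B : Set} (f : A → List B) {xs ys} → xs ↭ ys → concatMap f xs ⊆ concatMap f ys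
concatMap-↭ f {xs} σ m = ∈-concatMap⁺ f (Any-resp-↭ σ (∈-concatMap⁻ f {xs = xs} m))

module _ {n} (G : Graph n) where

  private
    V = Fin n

  open DecMembership (Fin._≟_ {n}) using (_∈?_)

  record Link : Set where
    field
      left right : V
      interior   : List V
      region     : List (Pair n)
      piece      : Piece G left right interior region
      left≢right : left ≢ right

    tips : List V
    tips = left ∷ right ∷ []

    direct : Set
    direct = Direct (Piece.kind piece)

  open Link

  Joins : Link → V → V → Set
  Joins p y z = (left p ≡ y × right p ≡ z) ⊎ (left p ≡ z × right p ≡ y)

  joins? : ∀ p y z → Dec (Joins p y z)
  joins? p y z = (left p Fin.≟ y ×-dec right p Fin.≟ z) ⊎-dec (left p Fin.≟ z ×-dec right p Fin.≟ y)

  joins-≢ : ∀ p {y z} → Joins p y z → y ≢ z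
  joins-≢ p (inj₁ (refl , refl)) = left≢right p
  joins-≢ p (inj₂ (refl , refl)) = ≢-sym (left≢right p)

  joins-tips : ∀ p {y z} → Joins p y z → tips p ⊆ y ∷ z ∷ []
  joins-tips p (inj₁ (refl , refl)) = id
  joins-tips p (inj₂ (refl , refl)) (here refl) = there (here refl)
  joins-tips p (inj₂ (refl , refl)) (there (here refl)) = here refl

  tips-joins : ∀ p {y z} → Joins p y z → y ∷ z ∷ [] ⊆ tips p
  tips-joins p (inj₁ (refl , refl)) = id
  tips-joins p (inj₂ (refl , refl)) (here refl) = there (here refl)
  tips-joins p (inj₂ (refl , refl)) (there (here refl)) = here refl

  tip-joins : ∀ p {x} → x ∈ tips p → ∃ (Joins p x)
  tip-joins p (here refl)         = right p , inj₁ (refl , refl)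
  tip-joins p (there (here refl)) = left p , inj₂ (refl , refl)

  joins-other : ∀ p {y z y′ z′} → Joins p y z → Joins p y′ z′ →
                (y ≡ y′ × z ≡ z′) ⊎ (y ≡ z′ × z ≡ y′)
  joins-other p (inj₁ (refl , refl)) (inj₁ e)       = inj₁ e
  joins-other p (inj₁ (refl , refl)) (inj₂ e)       = inj₂ e
  joins-other p (inj₂ (refl , refl)) (inj₁ (e , f)) = inj₂ (f , e)
  joins-other p (inj₂ (refl , refl)) (inj₂ (e , f)) = inj₁ (f , e)

  oriented : ∀ p {y z} → Joins p y z → ∃ λ (q : Piece G y z (interior p) (region p)) →
             Direct (Piece.kind q) → direct p
  oriented p (inj₁ (refl , refl)) = piece p , id
  oriented p (inj₂ (refl , refl)) = flipPiece G (piece p)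

  Parallels : Rel Link 0ℓ
  Parallels p q = Joins q (left p) (right p)

  parallels-sym : Symmetric Parallels
  parallels-sym (inj₁ (refl , refl)) = inj₁ (refl , refl)
  parallels-sym (inj₂ (refl , refl)) = inj₂ (refl , refl)

  parallels : ∀ p q {y z} → Joins p y z → Joins q y z → Parallels p q
  parallels p q (inj₁ (refl , refl)) j = j
  parallels p q (inj₂ (refl , refl)) j = Sum.swap j

  parallels⁻ : ∀ p q {y z} → Joins p y z → Parallels p q → Joins q y z
  parallels⁻ p q (inj₁ (refl , refl)) j = j
  parallels⁻ p q (inj₂ (refl , refl)) j = Sum.swap j

  Proper : Link → Set
  Proper p = Disjoint (tips p) (interior p)

  record Apart (p q : Link) : Set where
    field
      tipsˡ   : Disjoint (tips p) (interior q)
      tipsʳ   : Disjoint (tips q) (interior p)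
      inside  : Disjoint (interior p) (interior q)
      ¬double : Parallels p q → ¬ (direct p × direct q)

  open Apart

  apart-sym : Symmetric Apart
  apart-sym {p} {q} a = record
    { tipsˡ   = tipsʳ a
    ; tipsʳ   = tipsˡ a
    ; inside  = disjoint-sym (inside a)
    ; ¬double = λ j (d , e) → ¬double a (parallels-sym {q} {p} j) (e , d)
    }

  Network : List Link → Set
  Network ps = All Proper ps × AllPairs Apart ps

  network-↭ : ∀ {ps qs} → ps ↭ qs → Network ps → Network qs
  network-↭ σ (pr , ap) = All-resp-↭ σ pr , allPairs-resp-↭ apart-sym σ ap

  region* : List Link → List (Pair n)
  region* = concatMap region

  support : Link → List V
  support p = tips p ++ interior p

  support* : List Link → List V
  support* = concatMap support

  Solved : List Link → Set
  Solved ps = Solution G (region* ps) (support* ps) [] 3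

  solution-⊆ : ∀ {E E′ A A′ S w} → E′ ⊆ E → A ⊆ A′ → Solution G E A S w → Solution G E′ A′ S w
  solution-⊆ f g s = record
    { M = M ; C = C ; edges = edges ; matching = matching
    ; ends⊆ = g ∘ ends⊆ ; covers = covers ∘ f ; bound = bound }
    where open Solution s

  solved-↭ : ∀ {ps qs} → ps ↭ qs → Solved qs → Solved ps
  solved-↭ σ = solution-⊆ (concatMap-↭ region σ) (concatMap-↭ support (↭-sym σ))

  -- Beyond the old interiors, `r` may absorb a terminal, provided no remaining link ends there; so
  -- terminals and interiors stay apart. `single` preserves what is left of simplicity, without
  -- which a later parallel merge could fail.
  record Merge (p q r : Link) (rest : List Link) : Set where
    field
      tips-old     : tips r ⊆ tips p ++ tips q
      interior-old : ∀ {v} → v ∈ interior r → v ∈ interior p ++ interior q ⊎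
                     (v ∈ tips p ++ tips q × ∀ {o} → o ∈ rest → v ∉ tips o)
      proper       : Proper r
      covered      : region p ++ region q ⊆ region r
      single       : ∀ {o} → o ∈ rest → Parallels r o → direct r → ¬ direct o

  module _ {p q r rest} (m : Merge p q r rest) where

    open Merge m

    merge-network : Network (p ∷ q ∷ rest) → Network (r ∷ rest)
    merge-network (pp ∷ pq ∷ ps , (_ ∷ ap) ∷ aq ∷ ar) =
      proper ∷ ps , All.tabulate apart ∷ ar
      where
      apart : ∀ {o} → o ∈ rest → Apart r o
      apart {o} o∈ = record
        { tipsˡ   = tips′
        ; tipsʳ   = λ (t , i) → [ (λ k → [ (λ l → tipsʳ op (t , l)) , (λ l → tipsʳ oq (t , l)) ]′
                                            (∈-++⁻ (interior p) k))
                                , (λ (_ , ∉o) → ∉o o∈ t) ]′ (interior-old i)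
        ; inside  = λ (i , l) → [ (λ k → [ (λ h → inside op (h , l)) , (λ h → inside oq (h , l)) ]′
                                            (∈-++⁻ (interior p) k))
                                , (λ (k , _) → old k l) ]′ (interior-old i)
        ; ¬double = λ j (d , e) → single o∈ j d e
        }
        where
        op = All.lookup ap o∈
        oq = All.lookup aq o∈
        old : ∀ {v} → v ∈ tips p ++ tips q → v ∉ interior o
        old k l = [ (λ h → tipsˡ op (h , l)) , (λ h → tipsˡ oq (h , l)) ]′ (∈-++⁻ (tips p) k)
        tips′ : Disjoint (tips r) (interior o)
        tips′ (t , l) = old (tips-old t) l

    merge-solved : Solved (r ∷ rest) → Solved (p ∷ q ∷ rest)
    merge-solved = solution-⊆ regions supports
      where
      regions : region* (p ∷ q ∷ rest) ⊆ region* (r ∷ rest)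
      regions m with ∈-++⁻ (region p) m
      ... | inj₁ k = ∈-++⁺ˡ (covered (∈-++⁺ˡ k))
      ... | inj₂ k with ∈-++⁻ (region q) k
      ...   | inj₁ l = ∈-++⁺ˡ (covered (∈-++⁺ʳ (region p) l))
      ...   | inj₂ l = ∈-++⁺ʳ (region r) l
      from-tips : ∀ {v} → v ∈ tips p ++ tips q → v ∈ support* (p ∷ q ∷ rest)
      from-tips k with ∈-++⁻ (tips p) k
      ... | inj₁ l = ∈-++⁺ˡ {xs = support p} (∈-++⁺ˡ l)
      ... | inj₂ l = ∈-++⁺ʳ (support p) (∈-++⁺ˡ {xs = support q} (∈-++⁺ˡ l))
      supports : support* (r ∷ rest) ⊆ support* (p ∷ q ∷ rest)
      supports m with ∈-++⁻ (support r) m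
      ... | inj₂ k = ∈-++⁺ʳ (support p) (∈-++⁺ʳ (support q) k)
      ... | inj₁ k with ∈-++⁻ (tips r) k
      ...   | inj₁ t = from-tips (tips-old t)
      ...   | inj₂ i with interior-old i
      ...     | inj₂ (t , _) = from-tips t
      ...     | inj₁ h with ∈-++⁻ (interior p) h
      ...       | inj₁ l = ∈-++⁺ˡ (∈-++⁺ʳ (tips p) l)
      ...       | inj₂ l = ∈-++⁺ʳ (support p) (∈-++⁺ˡ (∈-++⁺ʳ (tips q) l))

  module _ {p q : Link} (proper-p : Proper p) (proper-q : Proper q) (apart : Apart p q) where

    module _ {y z} (jp : Joins p y z) (jq : Joins q y z) where

      merge-parallel : ∀ {rest} → (∀ {o} → o ∈ rest → Apart p o × Apart q o) →
                       ∃ λ r → Merge p q r rest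
      merge-parallel ap
        with parallelPiece G (proj₁ (oriented p jp)) (proj₁ (oriented q jq)) (joins-≢ p jp)
               (proper-p ∘ Product.map₁ (tips-joins p jp)) (proper-q ∘ Product.map₁ (tips-joins q jq))
               (inside apart)
               (λ (d , e) → ¬double apart (parallels p q jp jq)
                 (proj₂ (oriented p jp) d , proj₂ (oriented q jq) e))
      ... | r , dir = record { piece = r ; left≢right = joins-≢ p jp } , record
        { tips-old     = ∈-++⁺ˡ ∘ tips-joins p jp
        ; interior-old = inj₁
        ; proper       = λ (t , i) → [ (λ k → proper-p (tips-joins p jp t , k))
                                     , (λ k → proper-q (tips-joins q jq t , k)) ]′ (∈-++⁻ (interior p) i)
        ; covered      = id
        -- If `r` is direct, so is `p` or `q`, and that one was already parallel to `o`.
        ; single       = λ {o} o∈ j d e → [ (λ d′ → ¬double (proj₁ (ap o∈)) (parallels p o jp j) (proj₂ (oriented p jp) d′ , e))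
                                      , (λ d′ → ¬double (proj₂ (ap o∈)) (parallels q o jq j) (proj₂ (oriented q jq) d′ , e))
                                      ]′ (dir d)
        }

    module _ {x y z} (jp : Joins p x y) (y≢z : y ≢ z) where

      private
        outside-p : z ∈ tips q → Disjoint (x ∷ y ∷ z ∷ []) (interior p)
        outside-p z∈ (here refl , i)                 = proper-p (tips-joins p jp (here refl) , i)
        outside-p z∈ (there (here refl) , i)         = proper-p (tips-joins p jp (there (here refl)) , i)
        outside-p z∈ (there (there (here refl)) , i) = tipsʳ apart (z∈ , i)

        outside-q : z ∈ tips q → Disjoint (x ∷ y ∷ z ∷ []) (interior q)
        outside-q z∈ (here refl , i)                 = tipsˡ apart (tips-joins p jp (here refl) , i)
        outside-q z∈ (there (here refl) , i)         = tipsˡ apart (tips-joins p jp (there (here refl)) , i)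
        outside-q z∈ (there (there (here refl)) , i) = proper-q (z∈ , i)

        tips-yz : z ∈ tips q → y ∷ z ∷ [] ⊆ tips p ++ tips q
        tips-yz z∈ (here refl)         = ∈-++⁺ˡ (tips-joins p jp (there (here refl)))
        tips-yz z∈ (there (here refl)) = ∈-++⁺ʳ (tips p) z∈

        proper-yz : z ∈ tips q → x ≢ z → Disjoint (y ∷ z ∷ []) (x ∷ interior p ++ interior q)
        proper-yz z∈ x≢z (here refl , here refl) = joins-≢ p jp refl
        proper-yz z∈ x≢z (there (here refl) , here refl) = x≢z refl
        proper-yz z∈ x≢z (t , there i) with ∈-++⁻ (interior p) i
        ... | inj₁ k = outside-p z∈ (there t , k)
        ... | inj₂ k = outside-q z∈ (there t , k)

        interior-x : ∀ {rest : List Link} → (∀ {o} → o ∈ rest → x ∉ tips o) →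
                     ∀ {v} → v ∈ x ∷ interior p ++ interior q → v ∈ interior p ++ interior q ⊎
                     (v ∈ tips p ++ tips q × ∀ {o} → o ∈ rest → v ∉ tips o)
        interior-x x∉ (here refl) = inj₂ (∈-++⁺ˡ (tips-joins p jp (here refl)) , x∉)
        interior-x x∉ (there i)   = inj₁ i

      merge-series : Joins q x z → ∀ {rest} → (∀ {o} → o ∈ rest → x ∉ tips o) → ∃ λ r → Merge p q r rest
      merge-series jq {rest} x∉
        with seriesPiece G (proj₁ (oriented p jp)) (proj₁ (oriented q jq)) (joins-≢ p jp) (joins-≢ q jq) y≢z
               (outside-p (tips-joins q jq (there (here refl))))
               (outside-q (tips-joins q jq (there (here refl)))) (inside apart)
      ... | r , ¬dir = record { piece = r ; left≢right = y≢z } , record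
        { tips-old     = tips-yz (tips-joins q jq (there (here refl)))
        ; interior-old = interior-x {rest} x∉
        ; proper       = proper-yz (tips-joins q jq (there (here refl))) (joins-≢ q jq)
        ; covered      = id
        ; single       = λ _ _ d _ → ¬dir d
        }

      merge-pendant : Joins q y z → x ∉ tips q → ∀ {rest} → (∀ {o} → o ∈ rest → x ∉ tips o × Apart q o) →
                      ∃ λ r → Merge p q r rest
      merge-pendant jq x∉q {rest} x∉
        with pendantPiece G (proj₁ (oriented p jp)) (proj₁ (oriented q jq)) (joins-≢ p jp) x≢z y≢z
               (outside-p z∈) (outside-q z∈) (inside apart)
        where
        z∈ = tips-joins q jq (there (here refl))
        x≢z : x ≢ z
        x≢z refl = x∉q z∈
      ... | r , dir = record { piece = r ; left≢right = y≢z } , record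
        { tips-old     = tips-yz z∈
        ; interior-old = interior-x {rest} (proj₁ ∘ x∉)
        ; proper       = proper-yz z∈ λ { refl → x∉q z∈ }
        ; covered      = id
        ; single       = λ {o} o∈ j d e → ¬double (proj₂ (x∉ o∈)) (parallels q o jq j) (proj₂ (oriented q jq) (dir d) , e)
        }
        where z∈ = tips-joins q jq (there (here refl))

  solved-[] : Solved []
  solved-[] = record
    { M = [] ; C = [] ; edges = λ () ; matching = [] ; ends⊆ = λ () ; covers = λ () ; bound = ℕ.≤-refl }

  -- Such a link is a component by itself. By `closed` it contributes surplus at least 0, and its
  -- support is disjoint from all the others.
  close-solved : ∀ {p rest} → Network (p ∷ rest) → (∀ {o} → o ∈ rest → Disjoint (tips p) (tips o)) →
                 Solved rest → Solved (p ∷ rest)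
  close-solved {p} {rest} (pp ∷ _ , ap ∷ _) dis s =
    join G [] (closePiece G (piece p)) s apart ∈-++⁺ˡ (∈-++⁺ʳ (support p)) id id ℕ.≤-refl
    where
    apart : Disjoint (support p) (support* rest)
    apart (m , k) with find (∈-concatMap⁻ support {xs = rest} k)
    ... | o , o∈ , l with ∈-++⁻ (tips p) m | ∈-++⁻ (tips o) l
    ...   | inj₁ t | inj₁ t′ = dis o∈ (t , t′)
    ...   | inj₁ t | inj₂ i  = tipsˡ (All.lookup ap o∈) (t , i)
    ...   | inj₂ i | inj₁ t  = tipsʳ (All.lookup ap o∈) (t , i)
    ...   | inj₂ i | inj₂ i′ = inside (All.lookup ap o∈) (i , i′)

  skeleton : List Link → Graph n
  skeleton ps = record
    { Adj    = λ y z → ∃ λ p → p ∈ ps × Joins p y z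
    ; adj?   = λ y z → map′ find (λ (_ , p∈ , j) → lose p∈ j) (Any.any? (λ p → joins? p y z) ps)
    ; symm   = λ (p , p∈ , j) → p , p∈ , Sum.swap j
    ; irrefl = λ { refl (p , _ , j) → joins-≢ p j refl }
    }

  -- An interior vertex lies in the interior of one link and is a terminal of none, so it is
  -- isolated in the skeleton and determines the edge it came from.
  skeletonExpansion : ∀ {ps} → Network ps → AllPairs (λ p q → ¬ Parallels p q) ps → Expansion (skeleton ps) G
  skeletonExpansion {ps} (proper , apart) ¬par = record
    { inn          = inn
    ; inn-linked   = λ h → let p , _ , j , eq = spec h in
        subst (λ i → Linked (Adj G) (_ ∷ i ∷ʳ _)) (sym eq) (Piece.inner-linked (proj₁ (oriented p j)))
    ; inn-unique   = λ h → let p , _ , j , eq = spec h in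
        subst Unique (sym eq) (Piece.inner-unique (proj₁ (oriented p j)))
    ; inn-fresh    = λ h m (q , q∈ , j′) → let p , p∈ , j , i = interior-of h m in
        tips∌interior p∈ q∈ i (tips-joins q j′ (here refl))
    ; inn-disjoint = λ h h′ m m′ → let p , p∈ , j , i = interior-of h m ; q , q∈ , j′ , i′ = interior-of h′ m′ in
        same p∈ q∈ i i′ j j′
    }
    where
    -- The list follows the link that `adj?` finds; `spec` recovers that link from any proof of
    -- adjacency.
    inn : V → V → List V
    inn y z with adj? (skeleton ps) y z
    ... | yes (p , _ , j) = Piece.inner (proj₁ (oriented p j))
    ... | no _            = []
    spec : ∀ {y z} → Adj (skeleton ps) y z →
           ∃ λ p → p ∈ ps × ∃ λ (j : Joins p y z) → inn y z ≡ Piece.inner (proj₁ (oriented p j))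
    spec {y} {z} h with adj? (skeleton ps) y z
    ... | yes (p , p∈ , j) = p , p∈ , j , refl
    ... | no ¬h            = contradiction h ¬h
    interior-of : ∀ {y z u} → Adj (skeleton ps) y z → u ∈ inn y z →
                  ∃ λ p → p ∈ ps × Joins p y z × u ∈ interior p
    interior-of h m = let p , p∈ , j , eq = spec h in
      p , p∈ , j , Piece.inner⊆ (proj₁ (oriented p j)) (subst (_ ∈_) eq m)
    tips∌interior : ∀ {p q u} → p ∈ ps → q ∈ ps → u ∈ interior p → u ∉ tips q
    tips∌interior p∈ q∈ i t with allPairs-lookup apart p∈ q∈
    ... | inj₁ refl     = All.lookup proper p∈ (t , i)
    ... | inj₂ (inj₁ a) = tipsʳ a (t , i)
    ... | inj₂ (inj₂ a) = tipsˡ a (t , i)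
    same : ∀ {p q u y z y′ z′} → p ∈ ps → q ∈ ps → u ∈ interior p → u ∈ interior q →
           Joins p y z → Joins q y′ z′ → (y ≡ y′ × z ≡ z′) ⊎ (y ≡ z′ × z ≡ y′)
    same {p} p∈ q∈ i i′ j j′ with allPairs-lookup apart p∈ q∈
    ... | inj₁ refl     = joins-other p j j′
    ... | inj₂ (inj₁ a) = contradiction (i , i′) (inside a)
    ... | inj₂ (inj₂ a) = contradiction (i′ , i) (inside a)

  module _ (¬K₄ : ¬ TopMinor (complete 4) G) where

    private
      third? : ∀ (H : Graph n) x a b → Dec (∃ λ c → Adj H x c × c ≢ a × c ≢ b)
      third? H x a b = Fin.any? λ c → adj? H x c ×-dec ¬? (c Fin.≟ a) ×-dec ¬? (c Fin.≟ b)

    -- Otherwise `dirac` finds a subdivision of K₄ in the skeleton and `expandMinor` carries it into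
    -- `G`. All the quantifiers range over `Fin n`, so the exceptional vertex is found by search.
    low-degree : ∀ {p ps} → Network (p ∷ ps) → AllPairs (λ p q → ¬ Parallels p q) (p ∷ ps) →
                 ∃₂ λ x y → Adj (skeleton (p ∷ ps)) x y × ∃₂ λ a b →
                   ∀ {c} → Adj (skeleton (p ∷ ps)) x c → c ≡ a ⊎ c ≡ b
    low-degree {p} {ps} net ¬par with Fin.any? bad?
      where
      H = skeleton (p ∷ ps)
      bad? : ∀ x → Dec (∃ λ y → Adj H x y × ∃₂ λ a b → ¬ ∃ λ c → Adj H x c × c ≢ a × c ≢ b)
      bad? x = Fin.any? λ y → adj? H x y ×-dec Fin.any? λ a → Fin.any? λ b → ¬? (third? H x a b)
    ... | yes (x , y , h , a , b , none) = x , y , h , a , b , among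
      where
      among : ∀ {c} → Adj (skeleton (p ∷ ps)) x c → c ≡ a ⊎ c ≡ b
      among {c} h′ with c Fin.≟ a | c Fin.≟ b
      ... | yes e | _     = inj₁ e
      ... | no _  | yes e = inj₂ e
      ... | no ¬e | no ¬f = contradiction (c , h′ , ¬e , ¬f) none
    ... | no ¬bad = contradiction
      (expandMinor (skeletonExpansion net ¬par) (dirac H deg≥3 (p , here refl , inj₁ (refl , refl))) K₄-isolated)
      ¬K₄
      where
      H = skeleton (p ∷ ps)
      deg≥3 : ∀ {x y} → Adj H x y → ∀ a b → ∃ λ c → Adj H x c × c ≢ a × c ≢ b
      deg≥3 {x} h a b with third? H x a b
      ... | yes t = t
      ... | no ¬t = contradiction (x , _ , h , a , b , ¬t) ¬bad

    -- Every rule lowers the number of links. Without parallel links, take `x` with at most two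
    -- neighbours and a link `p` from `x` to `y`. A second link at `x` allows a series merge. If
    -- there is none, `p` is pendant when another link meets `y`, and a component when none does.
    solve : ∀ k ps → length ps ≤ k → Network ps → Solved ps
    solve-↭ : ∀ k {p q rest ps} → length ps ≤ suc k → ps ↭ p ∷ q ∷ rest → Network (p ∷ q ∷ rest) →
              (∃ λ r → Merge p q r rest) → Solved ps
    solve-↭ k le σ net (r , m) = solved-↭ σ (merge-solved m
      (solve k (r ∷ _) (ℕ.s≤s⁻¹ (subst (_≤ suc k) (↭-length σ) le)) (merge-network m net)))

    solve k       []       le net = solved-[]
    solve (suc k) ps@(_ ∷ _) le net with findPair (λ p q → joins? q (left p) (right p)) ps
    ... | inj₂ (p , q , par , rest , σ) with network-↭ σ net
    ...   | net′@(pp ∷ pq ∷ _ , (apq ∷ ap) ∷ aq ∷ _) =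
      solve-↭ k le σ net′ (merge-parallel pp pq apq (inj₁ (refl , refl)) par
        (λ o∈ → All.lookup ap o∈ , All.lookup aq o∈))
    solve (suc k) ps@(_ ∷ _) le net | inj₁ ¬par with low-degree net ¬par
    ... | x , y , (p , p∈ , jp) , a , b , among with extract p∈
    ...   | rest , σ with network-↭ σ net | allPairs-resp-↭ (λ {p} {q} ¬j j → ¬j (parallels-sym {q} {p} j)) σ ¬par
                      | Any.any? (λ o → x ∈? tips o) rest
    ...     | net′ | ¬p ∷ ¬par′ | yes any = at-x
      where
      at-x : Solved ps
      at-x with find any
      ... | q , q∈ , x∈q with tip-joins q x∈q | extract q∈
      ...   | z , jq | rest′ , ρ with network-↭ (prep p ρ) net′ | allPairs-resp-↭ (λ {p} {q} ¬j j → ¬j (parallels-sym {q} {p} j)) ρ ¬par′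
      ...     | net″@(pp ∷ pq ∷ _ , (apq ∷ _) ∷ _) | ¬q ∷ _ =
        solve-↭ k le (↭-trans σ (prep p ρ)) net″ (merge-series pp pq apq jp y≢z jq x∉)
        where
        y≢z : y ≢ z
        y≢z refl = All.lookup ¬p q∈ (parallels p q jp jq)
        x∉ : ∀ {o} → o ∈ rest′ → x ∉ tips o
        x∉ {o} o∈ x∈o with tip-joins o x∈o
        ... | w , jo = pigeon (among (p , p∈ , jp)) (among (q , ∈-resp-↭ (↭-sym σ) (there q∈) , jq))
                              (among (o , ∈-resp-↭ (↭-sym σ) (there o∈rest) , jo))
          where
          o∈rest = ∈-resp-↭ (↭-sym ρ) (there o∈)
          w≢y : w ≢ y
          w≢y refl = All.lookup ¬p o∈rest (parallels p o jp jo)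
          w≢z : w ≢ z
          w≢z refl = All.lookup ¬q o∈ (parallels q o jq jo)
          -- No two links are parallel, so `y`, `z` and `w` are distinct, yet all three are among
          -- `a` and `b`.
          pigeon : y ≡ a ⊎ y ≡ b → z ≡ a ⊎ z ≡ b → w ≡ a ⊎ w ≡ b → ⊥
          pigeon (inj₁ refl) (inj₁ e)    _           = y≢z (sym e)
          pigeon (inj₁ refl) (inj₂ refl) (inj₁ e)    = w≢y e
          pigeon (inj₁ refl) (inj₂ refl) (inj₂ e)    = w≢z e
          pigeon (inj₂ refl) (inj₂ e)    _           = y≢z (sym e)
          pigeon (inj₂ refl) (inj₁ refl) (inj₁ e)    = w≢z e
          pigeon (inj₂ refl) (inj₁ refl) (inj₂ e)    = w≢y e
    ...     | net′ | ¬p ∷ _ | no ¬any with Any.any? (λ o → y ∈? tips o) rest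
    ...       | yes any = at-y
      where
      x∉ : ∀ {o} → o ∈ rest → x ∉ tips o
      x∉ o∈ x∈o = ¬any (lose o∈ x∈o)
      at-y : Solved ps
      at-y with find any
      ... | q , q∈ , y∈q with tip-joins q y∈q | extract q∈
      ...   | z , jq | rest′ , ρ with network-↭ (prep p ρ) net′
      ...     | net″@(pp ∷ pq ∷ _ , (apq ∷ _) ∷ aq ∷ _) =
        solve-↭ k le (↭-trans σ (prep p ρ)) net″
          (merge-pendant pp pq apq jp (joins-≢ q jq) jq (x∉ q∈)
            (λ o∈ → x∉ (∈-resp-↭ (↭-sym ρ) (there o∈)) , All.lookup aq o∈))
    ...       | no ¬any′ = solved-↭ σ (close-solved net′ dis
      (solve k rest (ℕ.s≤s⁻¹ (subst (_≤ suc k) (↭-length σ) le)) (network-tail net′)))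
      where
      dis : ∀ {o} → o ∈ rest → Disjoint (tips p) (tips o)
      dis o∈ (t , t′) with joins-tips p jp t
      ... | here refl         = ¬any (lose o∈ t′)
      ... | there (here refl) = ¬any′ (lose o∈ t′)
      network-tail : ∀ {o os} → Network (o ∷ os) → Network os
      network-tail (_ ∷ pr , _ ∷ ap) = pr , ap

Hit : ∀ {n} → List (Pair n) → Fin n → Fin n → Set
Hit Y u w = (u , w) ∈ Y ⊎ (w , u) ∈ Y

hit-mono : ∀ {n} {Y Z : List (Pair n)} {u w} → Y ⊆ Z → Hit Y u w → Hit Z u w
hit-mono f = Sum.map f f

-- Matchings in graphs without a subdivision of K₄

module _ {n} (L : Graph n) where

  private
    edgeLink : ∀ {e} → IsEdge L e → Link L
    edgeLink {p , q} (lt , a) = record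
      { piece = edgePiece L a (Fin.<⇒≢ lt) ; left≢right = Fin.<⇒≢ lt }

    edgeLinks : ∀ {es} → All (IsEdge L) es → List (Link L)
    edgeLinks []       = []
    edgeLinks (a ∷ as) = edgeLink a ∷ edgeLinks as

    edgeLinks-proper : ∀ {es} (as : All (IsEdge L) es) → All (Proper L) (edgeLinks as)
    edgeLinks-proper []       = []
    edgeLinks-proper (a ∷ as) = (λ ()) ∷ edgeLinks-proper as

    edgeLinks-apart : ∀ {es} (as : All (IsEdge L) es) → Unique es → AllPairs (Apart L) (edgeLinks as)
    edgeLinks-apart []       []       = []
    edgeLinks-apart (a ∷ as) (e∉ ∷ u) = heads as e∉ ∷ edgeLinks-apart as u
      where
      heads : ∀ {es} (as : All (IsEdge L) es) → All (_ ≢_) es → All (Apart L (edgeLink a)) (edgeLinks as)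
      heads []       []       = []
      heads (b ∷ as) (ne ∷ e∉) = record
        { tipsˡ   = λ ()
        ; tipsʳ   = λ ()
        ; inside  = λ ()
        -- Distinct increasing pairs never have the same two ends, so no two edges are parallel.
        ; ¬double = λ { (inj₁ (refl , refl)) _ → ne refl
                      ; (inj₂ (refl , refl)) _ → ℕ.<-asym (proj₁ a) (proj₁ b) }
        } ∷ heads as e∉

    edgeLinks-region : ∀ {es} (as : All (IsEdge L) es) → es ⊆ region* L (edgeLinks as)
    edgeLinks-region (a ∷ as) (here refl) = here refl
    edgeLinks-region (a ∷ as) (there m)   = there (edgeLinks-region as m)

  Joined : List (Pair n) → List (Fin n) → Set
  Joined M C = (∀ {p q} → (p , q) ∈ M → Adj L p q) × Unique (ends M) ×
               (∀ {p q} → Adj L p q → Hit M p q ⊎ p ∈ C ⊎ q ∈ C) × length C ≤ length M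

  matching-cover : ¬ TopMinor (complete 4) L → ∃₂ Joined
  matching-cover ¬K₄ = M , C , edges , matching , cover , ℕ.+-cancelʳ-≤ 3 _ _ bound
    where
    es  = allEdges L
    all = proj₁ (allEdges-cover L)
    uni = proj₁ (proj₂ (allEdges-cover L))
    ls  = edgeLinks all
    open Solution (solve L ¬K₄ (length ls) ls ℕ.≤-refl (edgeLinks-proper all , edgeLinks-apart all uni))
    listed : ∀ {p q} → p < q → Adj L p q → Covered M (C ++ []) (p , q)
    listed lt a = covers (edgeLinks-region all
      (∈-filter⁺ (isEdge? L) (∈-cartesianProduct⁺ (∈-allFin _) (∈-allFin _)) (lt , a)))
    C⊇ : C ++ [] ⊆ C
    C⊇ m = [ id , (λ ()) ]′ (∈-++⁻ C m)
    cover : ∀ {p q} → Adj L p q → Hit M p q ⊎ p ∈ C ⊎ q ∈ C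
    cover {p} {q} a with Fin.<-cmp p q
    ... | tri< lt _ _ = Sum.map inj₁ (Sum.map C⊇ C⊇) (listed lt a)
    ... | tri≈ _ eq _ = contradiction a (irrefl L eq)
    ... | tri> _ _ gt = Sum.map inj₂ (Sum.swap ∘ Sum.map C⊇ C⊇) (listed gt (symm L a))

-- Neighbourhoods

-- The neighbourhood stays on `Fin n`, with all other vertices isolated, so matchings, covers and
-- paths in it need no translation back to `G`.
link : ∀ {n} → Graph n → Fin n → Graph n
link G v = record
  { Adj    = λ u w → Adj G u w × Adj G v u × Adj G v w
  ; adj?   = λ u w → adj? G u w ×-dec adj? G v u ×-dec adj? G v w
  ; symm   = λ (a , b , c) → symm G a , c , b
  ; irrefl = λ eq (a , _) → irrefl G eq a
  }

-- By `isolated` every branch vertex lies on a path, and all vertices on paths are neighbours of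
-- `v`. So `v` is adjacent to each branch vertex and, as there are no loops, lies on no path.
apex : ∀ {n k} (G : Graph n) v → (∀ i → ∃ λ j → IsEdge (complete k) (i , j) ⊎ IsEdge (complete k) (j , i)) →
       TopMinor (complete k) (link G v) → TopMinor (complete (suc k)) G
apex {n} {k} G v isolated t = record
  { branch           = branch′
  ; branch-injective = injective
  ; inner            = inner′
  ; path-linked      = linked
  ; path-unique      = unique
  ; inner∌branch     = fresh
  ; inner-disjoint   = disjoint
  }
  where
  open TopMinor t
  K = complete k
  branch′ : Fin (suc k) → Fin n
  branch′ zero    = v
  branch′ (suc i) = branch i
  inner′ : Pair (suc k) → List (Fin n)
  inner′ (zero  , _)     = []
  inner′ (suc i , zero)  = []
  inner′ (suc i , suc j) = inner (i , j)
  nbr : ∀ {e u} → IsEdge K e → u ∈ path e → Adj G v u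
  nbr {e} ke = All.lookup (nbrs (inner e) (path-linked ke))
    where
    nbrs : ∀ {a b} s → Linked (Adj (link G v)) (a ∷ s ∷ʳ b) → All (Adj G v) (a ∷ s ∷ʳ b)
    nbrs []      = linked-all proj₂
    nbrs (_ ∷ _) = linked-all proj₂
  v-branch : ∀ i → Adj G v (branch i)
  v-branch i with isolated i
  ... | j , inj₁ e = nbr e (here refl)
  ... | j , inj₂ e = nbr e (there (∈-++⁺ʳ (inner (j , i)) (here refl)))
  down : ∀ {i j} → IsEdge (complete (suc k)) (suc i , suc j) → IsEdge K (i , j)
  down (lt , ne) = ℕ.s<s⁻¹ lt , ne ∘ cong suc
  injective : ∀ {i j} → branch′ i ≡ branch′ j → i ≡ j
  injective {zero}  {zero}  eq = refl
  injective {zero}  {suc j} eq = contradiction (v-branch j) (irrefl G eq)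
  injective {suc i} {zero}  eq = contradiction (v-branch i) (irrefl G (sym eq))
  injective {suc i} {suc j} eq = cong suc (branch-injective eq)
  linked : ∀ {e} → IsEdge (complete (suc k)) e → Linked (Adj G) (branch′ (proj₁ e) ∷ inner′ e ∷ʳ branch′ (proj₂ e))
  linked {zero  , zero}  (() , _)
  linked {zero  , suc j} ke = v-branch j ∷ [-]
  linked {suc i , zero}  (() , _)
  linked {suc i , suc j} ke = Linked.map proj₁ (path-linked (down ke))
  unique : ∀ {e} → IsEdge (complete (suc k)) e → Unique (branch′ (proj₁ e) ∷ inner′ e ∷ʳ branch′ (proj₂ e))
  unique {zero  , zero}  (() , _)
  unique {zero  , suc j} ke = ((λ eq → irrefl G eq (v-branch j)) ∷ []) ∷ [] ∷ []
  unique {suc i , zero}  (() , _)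
  unique {suc i , suc j} ke = path-unique (down ke)
  fresh : ∀ {e} → IsEdge (complete (suc k)) e → ∀ i → branch′ i ∉ inner′ e
  fresh {suc i , suc j} ke zero    m = irrefl G refl (nbr (down ke) (there (∈-++⁺ˡ m)))
  fresh {suc i , suc j} ke (suc x) m = inner∌branch (down ke) x m
  disjoint : ∀ {e f} → IsEdge (complete (suc k)) e → IsEdge (complete (suc k)) f → e ≢ f →
             Disjoint (inner′ e) (inner′ f)
  disjoint {suc i , suc j} {suc i′ , suc j′} ke kf ne =
    inner-disjoint (down ke) (down kf) (λ { refl → ne refl })

topMinor-mono : ∀ {k n} {K : Graph k} {G H : Graph n} → (∀ {u w} → Adj H u w → Adj G u w) →
                TopMinor K H → TopMinor K G
topMinor-mono f t = record
  { branch = branch ; branch-injective = branch-injective ; inner = inner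
  ; path-linked = Linked.map f ∘ path-linked ; path-unique = path-unique
  ; inner∌branch = inner∌branch ; inner-disjoint = inner-disjoint }
  where open TopMinor t

-- Triangles

module _ {n} (G : Graph n) where

  private
    V = Fin n

  -- All that later arguments use about a sorted triangle, so the possible orders of its vertices
  -- are distinguished only in `triangle`.
  Spans : Triple n → List V → Set
  Spans t S = ∀ {x y} → (x , y) ∈ triangleEdges t → x ∈ S × y ∈ S

  triangle-adj : ∀ {t x y} → IsTriangle G t → (x , y) ∈ triangleEdges t → Adj G x y
  triangle-adj (_ , _ , ab , bc , ac) (here refl)                 = ab
  triangle-adj (_ , _ , ab , bc , ac) (there (here refl))         = bc
  triangle-adj (_ , _ , ab , bc , ac) (there (there (here refl))) = ac

  triangle : ∀ {a b c} → Adj G a b → Adj G b c → Adj G a c →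
             ∃ λ t → IsTriangle G t × Spans t (a ∷ b ∷ c ∷ [])
  triangle {a} {b} {c} ab bc ac = sorted
    where
    S = a ∷ b ∷ c ∷ []
    spans : ∀ {x y z} → x ∈ S → y ∈ S → z ∈ S → Spans (x , y , z) S
    spans p q r (here refl)                 = p , q
    spans p q r (there (here refl))         = q , r
    spans p q r (there (there (here refl))) = p , r
    a∈ : a ∈ S
    a∈ = here refl
    b∈ : b ∈ S
    b∈ = there (here refl)
    c∈ : c ∈ S
    c∈ = there (there (here refl))
    sorted : ∃ λ t → IsTriangle G t × Spans t S
    sorted with Fin.<-cmp a b | Fin.<-cmp b c | Fin.<-cmp a c
    ... | tri≈ _ eq _ | _           | _           = contradiction ab (irrefl G eq)
    ... | _           | tri≈ _ eq _ | _           = contradiction bc (irrefl G eq)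
    ... | _           | _           | tri≈ _ eq _ = contradiction ac (irrefl G eq)
    ... | tri< p _ _  | tri< q _ _  | _           = (a , b , c) , (p , q , ab , bc , ac) , spans a∈ b∈ c∈
    ... | tri< p _ _  | tri> _ _ q  | tri< r _ _  = (a , c , b) , (r , q , ac , symm G bc , ab) , spans a∈ c∈ b∈
    ... | tri< p _ _  | tri> _ _ q  | tri> _ _ r  = (c , a , b) , (r , p , symm G ac , ab , symm G bc) , spans c∈ a∈ b∈
    ... | tri> _ _ p  | tri< q _ _  | tri< r _ _  = (b , a , c) , (p , r , symm G ab , ac , bc) , spans b∈ a∈ c∈
    ... | tri> _ _ p  | tri< q _ _  | tri> _ _ r  = (b , c , a) , (q , r , bc , symm G ac , symm G ab) , spans b∈ c∈ a∈
    ... | tri> _ _ p  | tri> _ _ q  | _           = (c , b , a) , (q , p , symm G bc , symm G ab , symm G ac) , spans c∈ b∈ a∈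

  Covers : List (Pair n) → Set
  Covers Y = ∀ {a b c} → Adj G a b → Adj G b c → Adj G a c → Hit Y a b ⊎ Hit Y b c ⊎ Hit Y a c

  -- `Y` may contain reversed edges, non-edges and repetitions. Orienting, filtering and
  -- deduplicating remove them without making the list longer.
  cover : ∀ Y → Covers Y → ∃ λ Z → IsCover G Z × length Z ≤ length Y
  cover Y covers = Z , (All.tabulate edge , deduplicate-! _≟ᵖ_ _ , free) , le
    where
    orient : Pair n → Pair n
    orient (p , q) with p Fin.<? q
    ... | yes _ = p , q
    ... | no _  = q , p
    Z′ = filter (isEdge? G) (map orient Y)
    Z  = deduplicate _≟ᵖ_ Z′
    edge : ∀ {e} → e ∈ Z → IsEdge G e
    edge m = proj₂ (∈-filter⁻ (isEdge? G) {xs = map orient Y} (∈-deduplicate⁻ _≟ᵖ_ Z′ m))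
    oriented-hit : ∀ {a b} → a < b → Hit Y a b → (a , b) ∈ map orient Y
    oriented-hit {a} {b} lt (inj₁ m) with ∈-map⁺ orient m
    ... | k with a Fin.<? b
    ...   | yes _ = k
    ...   | no ≮b = contradiction lt ≮b
    oriented-hit {a} {b} lt (inj₂ m) with ∈-map⁺ orient m
    ... | k with b Fin.<? a
    ...   | yes gt = contradiction gt (ℕ.<-asym lt)
    ...   | no _   = k
    kept : ∀ {a b} → a < b → Adj G a b → Hit Y a b → (a , b) ∈ Z
    kept lt ab h = ∈-deduplicate⁺ _≟ᵖ_ (∈-filter⁺ (isEdge? G) (oriented-hit lt h) (lt , ab))
    free : TriangleFree (G -ᵉ Z)
    free (a , b , c) (a<b , b<c , (ab , ab∉ , _) , (bc , bc∉ , _) , (ac , ac∉ , _)) =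
      [ ab∉ ∘ kept a<b ab , [ bc∉ ∘ kept b<c bc , ac∉ ∘ kept (ℕ.<-trans a<b b<c) ac ]′ ]′ (covers ab bc ac)
    le : length Z ≤ length Y
    le = ℕ.≤-trans (length-deduplicate _≟ᵖ_ Z′)
           (ℕ.≤-trans (length-filter (isEdge? G) (map orient Y)) (ℕ.≤-reflexive (length-map orient Y)))

  delete : V → List (Pair n) → Graph n
  delete v M = record
    { Adj    = λ u w → Adj G u w × (u ≢ v × w ≢ v) × ¬ Hit M u w
    ; adj?   = λ u w → adj? G u w ×-dec (¬? (u Fin.≟ v) ×-dec ¬? (w Fin.≟ v)) ×-dec
                       ¬? ((u , w) ∈? M ⊎-dec (w , u) ∈? M)
    ; symm   = λ (a , (b , c) , d) → symm G a , (c , b) , d ∘ Sum.swap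
    ; irrefl = λ eq (a , _) → irrefl G eq a
    }
    where open DecMembership (_≟ᵖ_ {n}) using (_∈?_)

  -- Edges of `M` have no common ends, so two of the triangles share only `v`, and a common edge
  -- would be a loop at `v`.
  fans : ∀ v M → (∀ {p q} → (p , q) ∈ M → Adj (link G v) p q) → Unique (ends M) →
         ∃ λ ts → length ts ≡ length M × IsPacking G ts ×
           (∀ {t} → t ∈ ts → ∃₂ λ p q → (p , q) ∈ M × Spans t (v ∷ p ∷ q ∷ []))
  fans v []            adj u = [] , refl , ([] , []) , λ ()
  fans v ((p , q) ∷ M) adj ((_ ∷ p∉) ∷ q∉ ∷ u) with fans v M (adj ∘ there) u | adj (here refl)
  ... | ts , len , (tri , dis) , spans | pq , vp , vq with triangle vp pq vq
  ...   | t , it , st =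
    t ∷ ts , cong suc len , (it ∷ tri , All.tabulate apart ∷ dis) ,
    λ { (here refl) → p , q , here refl , st
      ; (there m)   → let p′ , q′ , k , s = spans m in p′ , q′ , there k , s }
    where
    ends-∈ : ∀ {M p q} → (p , q) ∈ M → p ∈ ends M × q ∈ ends M
    ends-∈ (here refl) = here refl , there (here refl)
    ends-∈ (there m)   = Product.map (there ∘ there) (there ∘ there) (ends-∈ m)
    apart : ∀ {t′} → t′ ∈ ts → EdgeDisjoint t t′
    apart t′∈ (e , e′) with spans t′∈
    ... | p′ , q′ , k , st′ =
      irrefl G (≡.trans (is-v (proj₁ (st e)) (proj₁ (st′ e′))) (sym (is-v (proj₂ (st e)) (proj₂ (st′ e′)))))
        (triangle-adj it e)
      where
      is-v : ∀ {x} → x ∈ v ∷ p ∷ q ∷ [] → x ∈ v ∷ p′ ∷ q′ ∷ [] → x ≡ v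
      is-v (here eq) _ = eq
      is-v _ (here eq) = eq
      is-v (there (here refl))         (there (here refl))         = contradiction (proj₁ (ends-∈ k)) (All≢⇒∉ p∉)
      is-v (there (here refl))         (there (there (here refl))) = contradiction (proj₂ (ends-∈ k)) (All≢⇒∉ p∉)
      is-v (there (there (here refl))) (there (here refl))         = contradiction (proj₁ (ends-∈ k)) (All≢⇒∉ q∉)
      is-v (there (there (here refl))) (there (there (here refl))) = contradiction (proj₂ (ends-∈ k)) (All≢⇒∉ q∉)

-- Induction on the vertices

-- Deleted vertices remain in `Fin n` as isolated ones, so the recursion is on a list `vs` of all
-- vertices that may still carry edges. The hypothesis on `G` passes to subgraphs by
-- `topMinor-mono`.
tuza : ∀ {n} vs (G : Graph n) → (∀ {u w} → Adj G u w → u ∈ vs) → ¬ TopMinor (complete 5) G →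
       ∃₂ λ ts Y → IsPacking G ts × Covers G Y × length Y ≤ 2 * length ts
tuza []       G on ¬K₅ = [] , [] , ([] , []) , (λ ab _ _ → contradiction (on ab) λ ()) , z≤n
tuza {n} (v ∷ vs) G on ¬K₅ with matching-cover (link G v) (¬K₅ ∘ apex G v K₄-isolated)
... | M , C , adj , uni , cov , le with fans G v M adj uni
...   | new , len , (new-tri , new-dis) , spans
  with tuza vs (delete G v M) on′ (¬K₅ ∘ topMinor-mono proj₁)
  where
  on′ : ∀ {u w} → Adj (delete G v M) u w → u ∈ vs
  on′ (a , (u≢v , _) , _) with on a
  ... | here eq = contradiction eq u≢v
  ... | there m = m
...     | old , Y , (old-tri , old-dis) , old-cov , old-le =
  new ++ old , Z ,
  (All.++⁺ new-tri (All.map keep old-tri) ,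
   AllPairs.++⁺ new-dis old-dis (All.tabulate λ t∈ → All.tabulate λ t′∈ → apart t∈ (All.lookup old-tri t′∈))) ,
  covers , bound
  where
  star = map (v ,_) C
  Z = M ++ star ++ Y
  H = delete G v M
  keep : ∀ {t} → IsTriangle H t → IsTriangle G t
  keep (p , q , ab , bc , ac) = p , q , proj₁ ab , proj₁ bc , proj₁ ac
  -- Every edge of a new triangle contains `v` or lies in `M`, and all such edges are absent from
  -- `H`.
  apart : ∀ {t t′} → t ∈ new → IsTriangle H t′ → EdgeDisjoint t t′
  apart t∈ it′ (e , e′) with spans t∈ | triangle-adj H it′ e′
  ... | p , q , pq∈ , st | xy , (x≢v , y≢v) , unhit = go (proj₁ (st e)) (proj₂ (st e))
    where
    go : _ ∈ v ∷ p ∷ q ∷ [] → _ ∈ v ∷ p ∷ q ∷ [] → ⊥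
    go (here eq) _ = x≢v eq
    go _ (here eq) = y≢v eq
    go (there (here refl))         (there (here refl))         = irrefl G refl xy
    go (there (here refl))         (there (there (here refl))) = unhit (inj₁ pq∈)
    go (there (there (here refl))) (there (here refl))         = unhit (inj₂ pq∈)
    go (there (there (here refl))) (there (there (here refl))) = irrefl G refl xy
  in-M : ∀ {a b} → Hit M a b → Hit Z a b
  in-M = hit-mono ∈-++⁺ˡ
  in-star : ∀ {c} → c ∈ C → Hit Z v c
  in-star m = inj₁ (∈-++⁺ʳ M (∈-++⁺ˡ (∈-map⁺ (v ,_) m)))
  in-Y : ∀ {a b} → Hit Y a b → Hit Z a b
  in-Y = hit-mono (∈-++⁺ʳ M ∘ ∈-++⁺ʳ star)
  at-v : ∀ {b c} → Adj G v b → Adj G b c → Adj G v c → Hit Z v b ⊎ Hit Z b c ⊎ Hit Z v c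
  at-v vb bc vc with cov (bc , vb , vc)
  ... | inj₁ h        = inj₂ (inj₁ (in-M h))
  ... | inj₂ (inj₁ m) = inj₁ (in-star m)
  ... | inj₂ (inj₂ m) = inj₂ (inj₂ (in-star m))
  covers : Covers G Z
  covers {a} {b} {c} ab bc ac with a Fin.≟ v | b Fin.≟ v | c Fin.≟ v
  ... | yes refl | _ | _ = at-v ab bc ac
  ... | no _ | yes refl | _ =
    [ inj₁ ∘ Sum.swap , [ inj₂ ∘ inj₂ , inj₂ ∘ inj₁ ]′ ]′ (at-v (symm G ab) ac bc)
  ... | no _ | no _ | yes refl =
    [ inj₂ ∘ inj₂ ∘ Sum.swap , [ inj₁ , inj₂ ∘ inj₁ ∘ Sum.swap ]′ ]′ (at-v (symm G ac) ab (symm G bc))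
  ... | no a≢ | no b≢ | no c≢ with hit? a b | hit? b c | hit? a c
    where
    open DecMembership (_≟ᵖ_ {n}) using (_∈?_)
    hit? : ∀ x y → Dec (Hit M x y)
    hit? x y = (x , y) ∈? M ⊎-dec (y , x) ∈? M
  ...   | yes h | _ | _ = inj₁ (in-M h)
  ...   | no _ | yes h | _ = inj₂ (inj₁ (in-M h))
  ...   | no _ | no _ | yes h = inj₂ (inj₂ (in-M h))
  ...   | no h | no h′ | no h″ =
    Sum.map in-Y (Sum.map in-Y in-Y)
      (old-cov (ab , (a≢ , b≢) , h) (bc , (b≢ , c≢) , h′) (ac , (a≢ , c≢) , h″))
  bound : length Z ≤ 2 * length (new ++ old)
  bound = begin
    length Z
      ≡⟨ ≡.trans (length-++ M) (cong (length M +_) (≡.trans (length-++ star) (cong (_+ length Y) (length-map (v ,_) C)))) ⟩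
    length M + (length C + length Y)
      ≤⟨ ℕ.+-monoʳ-≤ (length M) (ℕ.+-mono-≤ le old-le) ⟩
    length M + (length M + 2 * length old)
      ≡⟨ double (length M) (length old) ⟩
    2 * (length M + length old)
      ≡⟨ cong (2 *_) (≡.trans (cong (_+ length old) (sym len)) (sym (length-++ new))) ⟩
    2 * length (new ++ old) ∎
    where
    open ℕ.≤-Reasoning
    double : ∀ m o → m + (m + 2 * o) ≡ 2 * (m + o)
    double = solve-∀

theorem3p8 : ∀ (n : ℕ) (G : Graph n) → ¬ ContainsSubdivision (complete 5) G → τ G ≤ 2 * ν G
theorem3p8 n G ¬K₅ with tuza (allFin n) G (λ _ → ∈-allFin _) (¬K₅ ∘ topMinor⇒subdivision)
... | ts , Y , packing , covers , le with cover G Y covers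
...   | Z , isCover , le′ = ℕ.≤-trans (proj₂ (τ-isMinimum G) (Z , refl , isCover))
  (ℕ.≤-trans le′ (ℕ.≤-trans le (ℕ.*-monoʳ-≤ 2 (proj₂ (ν-isMaximum G) (ts , refl , packing)))))
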